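{- Let $p$ be an odd prime and $n$ an integer with $6\le 2n\le p-1$. Then $$A_{2n}\equiv\frac{p^2}{2}\mathcal{C}(2n)-p\,\mathcal{B}_{2n}-\frac{p^3}{6}\,\mathcal{T}(2n)-\frac{16n^2-12n+5}{24}\,p^3\,\mathcal{B}_{2n-2}\pmod{p^4}.$$
   Context: $A_k:=\sum_{1\le i_1<\dots<i_k\le p-1}i_1\cdots i_k$ (the unsigned Stirling number of the first kind counting permutations of $p$ letters with $p-k$ cycles). $B_n$ is the $n$-th Bernoulli number and $\mathcal{B}_n:=B_n/n$. For even $n\ge4$, $\mathcal{C}(n):=\sum_{i=2}^{n-2}\mathcal{B}_i\mathcal{B}_{n-i}$ and $\mathcal{T}(n):=\sum_{i=2}^{n-4}\mathcal{B}_i\mathcal{C}(n-i)$ (sum of products of three divided Bernoulli numbers with indices $\ge2$ summing to $n$, over ordered triples). Congruences are in $\mathbb{Q}_p$: difference in $p^4\mathbb{Z}_p$. -}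

module Defs where

open import Data.Nat as ℕ using (ℕ; zero; suc; _∸_)
open import Data.Nat.Combinatorics using (_C_)
open import Data.Nat.Divisibility using (_∣_)
open import Data.Integer as ℤ using (ℤ; +_)
open import Data.Rational using (ℚ; 0ℚ; 1ℚ; _+_; _*_; -_; _/_; ↥_; ↧ₙ_)
open import Data.List using (List; []; _∷_; _++_; length)
open import Data.Product using (_×_)
open import Relation.Nullary using (¬_)

ℕ→ℚ : ℕ → ℚ
ℕ→ℚ n = (+ n) / 1

-- Σ_{i=a}^{b} f i  (empty, i.e. 0, when b < a)
sumFromTo : ℕ → ℕ → (ℕ → ℚ) → ℚ
sumFromTo a b f = go (suc b ∸ a) a
  where
  go : ℕ → ℕ → ℚ
  go zero    i = 0ℚ
  go (suc k) i = f i + go k (suc i)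

-- Bernoulli numbers (convention B_1 = -1/2), via the standard recurrence
--   B_0 = 1,  B_m = -(1/(m+1)) Σ_{k=0}^{m-1} C(m+1,k) B_k  (m ≥ 1).
-- nextB m [B_0,…,B_{m-1}] = B_m
nextB : ℕ → List ℚ → ℚ
nextB zero    _  = 1ℚ
nextB (suc m) bs = - ((+ 1 / (suc (suc m))) * go 0 bs)
  where
  go : ℕ → List ℚ → ℚ
  go k []       = 0ℚ
  go k (b ∷ bs) = ℕ→ℚ ((suc (suc m)) C k) * b + go (suc k) bs

bernList : ℕ → List ℚ
bernList zero    = []
bernList (suc m) = bernList m ++ (nextB m (bernList m) ∷ [])

B : ℕ → ℚ
B m = nextB m (bernList m)

-- divided Bernoulli number 𝓑 n = B_n / n  (n ≥ 1; the value at 0 is never used)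
𝓑 : ℕ → ℚ
𝓑 zero    = 0ℚ
𝓑 (suc n) = B (suc n) * (+ 1 / suc n)

𝓒 : ℕ → ℚ
𝓒 n = sumFromTo 2 (n ∸ 2) (λ i → 𝓑 i * 𝓑 (n ∸ i))

𝓣 : ℕ → ℚ
𝓣 n = sumFromTo 2 (n ∸ 4) (λ i → 𝓑 i * 𝓒 (n ∸ i))

elemSym : ℕ → List ℕ → ℕ
elemSym zero    _        = 1
elemSym (suc k) []       = 0
elemSym (suc k) (x ∷ xs) = x ℕ.* elemSym k xs ℕ.+ elemSym (suc k) xs

range1 : ℕ → List ℕ
range1 zero    = []
range1 (suc m) = range1 m ++ (suc m ∷ [])

A : ℕ → ℕ → ℕ
A p k = elemSym k (range1 (p ∸ 1))

-- x ∈ p^k ℤ_p  for a rational x (written in lowest terms):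
-- p^k divides the numerator and p does not divide the denominator
InPowZp : ℕ → ℕ → ℚ → Set
InPowZp p k x = (p ℕ.^ k) ∣ ℤ.∣ ↥ x ∣ × ¬ (p ∣ (↧ₙ x))

_≡_[mod_^_] : ℚ → ℚ → ℕ → ℕ → Set
x ≡ y [mod p ^ k ] = InPowZp p k (x - y)
  where open Data.Rational using (_-_)

{-# OPTIONS --safe #-}
-- Write S_i for the sum of the i-th powers of 1, …, p - 1 and G = Σ_{i≥1} (S_i / i) X^i. By Newton's identities
-- Σ (-1)^k A_k X^k = exp(-G), and Faulhaber's formula gives, for i ≤ 2n,
--   G ≡ p b + p² c + p³ d  (mod p⁴),   b_i = B_i / i,  c_i = B_{i-1} / 2,  d_i = (i - 1) B_{i-2} / 6.
-- Below index p - 1 all coefficients of G are divisible by p, so modulo p⁴ the exponential may be cut off to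
-- 1 - G + G²/2 - G³/6; the two series are compared through the differential equation of exp with θ = X d/dX.
-- Now b = β - X/2 with β even, by the vanishing of B_3, B_5, …. The coefficients of β² and β³ at 2n are 𝓒 and 𝓣,
-- and d, b c and the part of b³ quadratic in X/2 together contribute the B_{2n-2} term.
module Submission where

open import Defs

-- The obstacle is the boundary case 2n = p - 1. There B_{2n} has p in its denominator and S_{2n} is
-- not divisible by p, so neither G nor p b is small at index 2n itself. Two facts rescue the
-- estimates. The series multiplied in them have constant term 0, so the coefficient of a product at
-- 2n only sees indices below 2n, where the B_i are p-integral and every factor carries its expected
-- power of p. In the linear term only the difference between G and its approximation matters.
-- Faulhaber's formula controls that difference after multiplication by 2n (2n + 1); when 2n + 1 =
-- p, the division costs a factor p, which the vanishing of B_{p-4} gives back. Comparing through θ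
-- avoids constructing exp(-G): a solution of θF = -S F is determined by its constant term, and a
-- defect in p⁴ stays in p⁴ because only indices less than p are divided by.

module Development where

  open import Data.Nat as ℕ using (ℕ; zero; suc; s≤s; z≤n)
  import Data.Nat.Properties as ℕ
  open import Data.Nat.Combinatorics using (_C_; nCk+nC[k+1]≡[n+1]C[k+1]; nCn≡1; nC1≡n; nCk≡nC[n∸k]; k>n⇒nCk≡0)
  open import Data.Nat.Coprimality using (coprime-divisor) renaming (sym to Coprime-sym; recompute to recompute-coprime)
  open import Data.Nat.Divisibility using (_∣_; _∤_; divides; ∣⇒≤; *-cancelˡ-∣; m∣m*n; ∣-trans)
  open import Data.Nat.Induction using (<-rec)
  open import Data.Nat.Primality using (Prime; euclidsLemma; prime⇒nonZero; prime⇒nonTrivial)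
  open import Data.Integer as ℤ using (ℤ; +_; ∣_∣)
  import Data.Integer.Properties as ℤ
  open import Data.Rational using (ℚ; mkℚ; 0ℚ; 1ℚ; _+_; _*_; -_; _-_; _/_; ↥_; ↧ₙ_; toℚᵘ)
  import Data.Rational.Unnormalised as ℚᵘ
  import Data.Rational.Unnormalised.Properties as ℚᵘ
  open import Data.Rational.Properties
  open import Data.Rational.Solver using (module +-*-Solver)
  open +-*-Solver using (solve; con; _:+_; _:*_; :-_; _:-_; _:=_)
  open import Data.List using (List; []; _∷_; _++_; length)
  open import Data.List.Properties using (length-++)
  open import Data.Product using (_,_)
  open import Data.Sum using (inj₁; inj₂; [_,_]′)
  open import Function using (_∘_)
  open import Level using (0ℓ)
  open import Relation.Binary.Bundles using (Setoid)
  open import Relation.Binary.PropositionalEquality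
  open import Relation.Nullary using (contradiction)
  open import Algebra.Bundles using (CommutativeSemiring)
  import Algebra.Solver.Ring.NaturalCoefficients.Default as NatSolver
  open import Algebra.Structures.Biased {A = ℕ → ℚ} _≗_ using (isCommutativeSemiringˡ)
  open ≡-Reasoning

  -- Powers, and the embedding of natural numbers and integers into ℚ

  infixr 8 _^^_
  _^^_ : ℚ → ℕ → ℚ
  x ^^ zero  = 1ℚ
  x ^^ suc k = x * x ^^ k

  toℚᵘ-/1 : ∀ n → toℚᵘ (n / 1) ℚᵘ.≃ ℚᵘ.mkℚᵘ n 0
  toℚᵘ-/1 n = toℚᵘ-fromℚᵘ (ℚᵘ.mkℚᵘ n 0)

  /1-homo-+ : ∀ m n → (m ℤ.+ n) / 1 ≡ m / 1 + n / 1
  /1-homo-+ m n = toℚᵘ-injective (ℚᵘ.≃-trans (toℚᵘ-/1 (m ℤ.+ n)) (ℚᵘ.≃-sym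
    (ℚᵘ.≃-trans (toℚᵘ-homo-+ (m / 1) (n / 1)) (ℚᵘ.≃-trans (ℚᵘ.+-cong (toℚᵘ-/1 m) (toℚᵘ-/1 n))
      (ℚᵘ.*≡* (cong (ℤ._* + 1) (cong₂ ℤ._+_ (ℤ.*-identityʳ m) (ℤ.*-identityʳ n))))))))

  /1-homo-* : ∀ m n → (m ℤ.* n) / 1 ≡ m / 1 * (n / 1)
  /1-homo-* m n = toℚᵘ-injective (ℚᵘ.≃-trans (toℚᵘ-/1 (m ℤ.* n)) (ℚᵘ.≃-sym
    (ℚᵘ.≃-trans (toℚᵘ-homo-* (m / 1) (n / 1)) (ℚᵘ.*-cong (toℚᵘ-/1 m) (toℚᵘ-/1 n)))))

  /1-injective : ∀ {m n} → m / 1 ≡ n / 1 → m ≡ n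
  /1-injective {m} {n} eq with ℚᵘ.≃-trans (ℚᵘ.≃-sym (toℚᵘ-/1 m)) (ℚᵘ.≃-trans (toℚᵘ-cong eq) (toℚᵘ-/1 n))
  ... | ℚᵘ.*≡* e = trans (sym (ℤ.*-identityʳ m)) (trans e (ℤ.*-identityʳ n))

  ℕ→ℚ-+ : ∀ m n → ℕ→ℚ (m ℕ.+ n) ≡ ℕ→ℚ m + ℕ→ℚ n
  ℕ→ℚ-+ m n = /1-homo-+ (+ m) (+ n)

  ℕ→ℚ-* : ∀ m n → ℕ→ℚ (m ℕ.* n) ≡ ℕ→ℚ m * ℕ→ℚ n
  ℕ→ℚ-* m n = trans (cong (_/ 1) (ℤ.pos-* m n)) (/1-homo-* (+ m) (+ n))

  ℕ→ℚ-suc : ∀ n → ℕ→ℚ (suc n) ≡ 1ℚ + ℕ→ℚ n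
  ℕ→ℚ-suc n = ℕ→ℚ-+ 1 n

  1/n*n≡1 : ∀ n → (+ 1 / suc n) * ℕ→ℚ (suc n) ≡ 1ℚ
  1/n*n≡1 n = toℚᵘ-injective (ℚᵘ.≃-trans (toℚᵘ-homo-* (+ 1 / suc n) (ℕ→ℚ (suc n)))
    (ℚᵘ.≃-trans (ℚᵘ.*-cong (toℚᵘ-fromℚᵘ (ℚᵘ.mkℚᵘ (+ 1) n)) (toℚᵘ-/1 (+ suc n)))
      (ℚᵘ.*≡* (ℤ.*-assoc (+ 1) (+ suc n) (+ 1)))))

  *-cancel-suc : ∀ n {x y} → ℕ→ℚ (suc n) * x ≡ ℕ→ℚ (suc n) * y → x ≡ y
  *-cancel-suc n {x} {y} e = trans (sym (lem x)) (trans (cong ((+ 1 / suc n) *_) e) (lem y))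
    where
    lem : ∀ z → (+ 1 / suc n) * (ℕ→ℚ (suc n) * z) ≡ z
    lem z = trans (sym (*-assoc (+ 1 / suc n) (ℕ→ℚ (suc n)) z))
                  (trans (cong (_* z) (1/n*n≡1 n)) (*-identityˡ z))

  -- Formal power series over ℚ

  infixl 7 _⊛_ _⋆_
  infixl 6 _⊕_

  Series : Set
  Series = ℕ → ℚ

  _⊕_ : Series → Series → Series
  (f ⊕ g) n = f n + g n

  _⋆_ : ℚ → Series → Series
  (c ⋆ f) n = c * f n

  𝟘 : Series
  𝟘 _ = 0ℚ

  monomial : ℚ → ℕ → Series
  monomial c zero    zero    = c
  monomial c zero    (suc n) = 0ℚ
  monomial c (suc k) zero    = 0ℚ
  monomial c (suc k) (suc n) = monomial c k n

  -- The Cauchy product, unfolded along the left factor: no index is subtracted, and inductions pass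
  -- to the tail `f ∘ suc`.
  _⊛_ : Series → Series → Series
  (f ⊛ g) zero    = f 0 * g 0
  (f ⊛ g) (suc n) = f 0 * g (suc n) + (f ∘ suc ⊛ g) n

  θ : Series → Series
  θ f n = ℕ→ℚ n * f n

  ⊛-cong : ∀ {f f′ g g′} → f ≗ f′ → g ≗ g′ → f ⊛ g ≗ f′ ⊛ g′
  ⊛-cong e e′ zero    = cong₂ _*_ (e 0) (e′ 0)
  ⊛-cong e e′ (suc n) = cong₂ _+_ (cong₂ _*_ (e 0) (e′ (suc n))) (⊛-cong (e ∘ suc) e′ n)

  ⊛-congˡ : ∀ f {g g′} → g ≗ g′ → f ⊛ g ≗ f ⊛ g′
  ⊛-congˡ f e = ⊛-cong {f} (λ _ → refl) e

  ⊛-congʳ : ∀ {f f′} g → f ≗ f′ → f ⊛ g ≗ f′ ⊛ g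
  ⊛-congʳ g e = ⊛-cong {g = g} e (λ _ → refl)

  ⊛-distribʳ : ∀ h f g → (f ⊕ g) ⊛ h ≗ f ⊛ h ⊕ g ⊛ h
  ⊛-distribʳ h f g zero    = *-distribʳ-+ (h 0) (f 0) (g 0)
  ⊛-distribʳ h f g (suc n) = trans (cong (_+_ ((f 0 + g 0) * h (suc n))) (⊛-distribʳ h (f ∘ suc) (g ∘ suc) n))
    (solve 5 (λ a b c d e → (a :+ b) :* c :+ (d :+ e) := (a :* c :+ d) :+ (b :* c :+ e)) refl
      (f 0) (g 0) (h (suc n)) ((f ∘ suc ⊛ h) n) ((g ∘ suc ⊛ h) n))

  ⋆-⊛ : ∀ c f g → (c ⋆ f) ⊛ g ≗ c ⋆ (f ⊛ g)
  ⋆-⊛ c f g zero    = *-assoc c (f 0) (g 0)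
  ⋆-⊛ c f g (suc n) = trans (cong (_+_ (c * f 0 * g (suc n))) (⋆-⊛ c (f ∘ suc) g n))
    (solve 4 (λ c x y z → c :* x :* y :+ c :* z := c :* (x :* y :+ z)) refl c (f 0) (g (suc n)) ((f ∘ suc ⊛ g) n))

  ⊛-zeroˡ : ∀ g → 𝟘 ⊛ g ≗ 𝟘
  ⊛-zeroˡ g zero    = *-zeroˡ (g 0)
  ⊛-zeroˡ g (suc n) = trans (cong₂ _+_ (*-zeroˡ (g (suc n))) (⊛-zeroˡ g n)) (+-identityˡ 0ℚ)

  -- The mirror image of the defining equation, peeling off the right factor; it makes commutativity
  -- inductive.
  ⊛-unfoldʳ : ∀ f g n → (f ⊛ g) (suc n) ≡ f (suc n) * g 0 + (f ⊛ (g ∘ suc)) n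
  ⊛-unfoldʳ f g zero    = +-comm (f 0 * g 1) (f 1 * g 0)
  ⊛-unfoldʳ f g (suc n) = trans (cong (_+_ (f 0 * g (suc (suc n)))) (⊛-unfoldʳ (f ∘ suc) g n))
    (solve 3 (λ x y z → x :+ (y :+ z) := y :+ (x :+ z)) refl
      (f 0 * g (suc (suc n))) (f (suc (suc n)) * g 0) ((f ∘ suc ⊛ (g ∘ suc)) n))

  ⊛-comm : ∀ f g → f ⊛ g ≗ g ⊛ f
  ⊛-comm f g zero    = *-comm (f 0) (g 0)
  ⊛-comm f g (suc n) = trans (cong₂ _+_ (*-comm (f 0) (g (suc n))) (⊛-comm (f ∘ suc) g n))
    (sym (⊛-unfoldʳ g f n))

  ⊛-assoc : ∀ f g h → (f ⊛ g) ⊛ h ≗ f ⊛ (g ⊛ h)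
  ⊛-assoc f g h zero    = *-assoc (f 0) (g 0) (h 0)
  ⊛-assoc f g h (suc n) = begin
    f 0 * g 0 * h (suc n) + ((f 0 ⋆ (g ∘ suc) ⊕ (f ∘ suc) ⊛ g) ⊛ h) n
      ≡⟨ cong (_+_ (f 0 * g 0 * h (suc n))) (trans (⊛-distribʳ h (f 0 ⋆ (g ∘ suc)) ((f ∘ suc) ⊛ g) n)
           (cong₂ _+_ (⋆-⊛ (f 0) (g ∘ suc) h n) (⊛-assoc (f ∘ suc) g h n))) ⟩
    f 0 * g 0 * h (suc n) + (f 0 * ((g ∘ suc) ⊛ h) n + ((f ∘ suc) ⊛ (g ⊛ h)) n)
      ≡⟨ solve 5 (λ x y z u v → x :* y :* z :+ (x :* u :+ v) := x :* (y :* z :+ u) :+ v) refl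
           (f 0) (g 0) (h (suc n)) (((g ∘ suc) ⊛ h) n) (((f ∘ suc) ⊛ (g ⊛ h)) n) ⟩
    f 0 * (g 0 * h (suc n) + ((g ∘ suc) ⊛ h) n) + ((f ∘ suc) ⊛ (g ⊛ h)) n ∎

  monomial0-⊛ : ∀ c f → monomial c 0 ⊛ f ≗ c ⋆ f
  monomial0-⊛ c f zero    = refl
  monomial0-⊛ c f (suc n) = trans (cong (_+_ (c * f (suc n))) (⊛-zeroˡ f n)) (+-identityʳ (c * f (suc n)))

  monomial1-⊛-suc : ∀ c f n → (monomial c 1 ⊛ f) (suc n) ≡ c * f n
  monomial1-⊛-suc c f n = trans (cong₂ _+_ (*-zeroˡ (f (suc n))) (monomial0-⊛ c f n)) (+-identityˡ (c * f n))

  -- Serves the solver for identities between series. Signs and rational scalars stay outside, in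
  -- `_⋆_` or inside atoms, so natural coefficients are enough.
  seriesSemiring : CommutativeSemiring 0ℓ 0ℓ
  seriesSemiring = record
    { _≈_ = _≗_ ; _+_ = _⊕_ ; _*_ = _⊛_ ; 0# = 𝟘 ; 1# = monomial 1ℚ 0
    ; isCommutativeSemiring = isCommutativeSemiringˡ record
      { +-isCommutativeMonoid = record
        { isMonoid = record
          { isSemigroup = record
            { isMagma = record
              { isEquivalence = Setoid.isEquivalence (ℕ →-setoid ℚ)
              ; ∙-cong = λ e e′ n → cong₂ _+_ (e n) (e′ n) }
            ; assoc = λ f g h n → +-assoc (f n) (g n) (h n) }
          ; identity = (λ f n → +-identityˡ (f n)) , (λ f n → +-identityʳ (f n)) }
        ; comm = λ f g n → +-comm (f n) (g n) }
      ; *-isCommutativeMonoid = record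
        { isMonoid = record
          { isSemigroup = record
            { isMagma = record
              { isEquivalence = Setoid.isEquivalence (ℕ →-setoid ℚ)
              ; ∙-cong = ⊛-cong }
            ; assoc = ⊛-assoc }
          ; identity = one-⊛ , (λ f n → trans (⊛-comm f (monomial 1ℚ 0) n) (one-⊛ f n)) }
        ; comm = ⊛-comm }
      ; distribʳ = ⊛-distribʳ
      ; zeroˡ = ⊛-zeroˡ
      }
    }
    where
    one-⊛ : ∀ f → monomial 1ℚ 0 ⊛ f ≗ f
    one-⊛ f n = trans (monomial0-⊛ 1ℚ f n) (*-identityˡ (f n))

  open CommutativeSemiring seriesSemiring public using () renaming (distribˡ to ⊛-distribˡ)
  module SeriesSolver = NatSolver seriesSemiring

  ⊛-⋆ : ∀ c f g → f ⊛ (c ⋆ g) ≗ c ⋆ (f ⊛ g)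
  ⊛-⋆ c f g n = trans (⊛-comm f (c ⋆ g) n) (trans (⋆-⊛ c g f n) (cong (c *_) (⊛-comm g f n)))

  θ-tail : ∀ f → θ f ∘ suc ≗ θ (f ∘ suc) ⊕ (f ∘ suc)
  θ-tail f n = trans (cong (_* f (suc n)) (ℕ→ℚ-suc n))
    (solve 2 (λ m x → (con 1ℚ :+ m) :* x := m :* x :+ x) refl (ℕ→ℚ n) (f (suc n)))

  θ-⊛ : ∀ f g → θ (f ⊛ g) ≗ θ f ⊛ g ⊕ f ⊛ θ g
  θ-⊛ f g zero    = solve 2 (λ x y → con 0ℚ :* (x :* y) := con 0ℚ :* x :* y :+ x :* (con 0ℚ :* y)) refl (f 0) (g 0)
  θ-⊛ f g (suc n) = begin
    ℕ→ℚ (suc n) * (f 0 * g (suc n) + fg n)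
      ≡⟨ solve 4 (λ m x y z → m :* (x :* y :+ z) := x :* (m :* y) :+ m :* z) refl (ℕ→ℚ (suc n)) (f 0) (g (suc n)) (fg n) ⟩
    f 0 * θ g (suc n) + ℕ→ℚ (suc n) * fg n
      ≡⟨ cong (λ m → f 0 * θ g (suc n) + m * fg n) (ℕ→ℚ-suc n) ⟩
    f 0 * θ g (suc n) + (1ℚ + ℕ→ℚ n) * fg n
      ≡⟨ solve 3 (λ x m z → x :+ (con 1ℚ :+ m) :* z := x :+ (m :* z :+ z)) refl (f 0 * θ g (suc n)) (ℕ→ℚ n) (fg n) ⟩
    f 0 * θ g (suc n) + (θ fg n + fg n)
      ≡⟨ cong (λ w → f 0 * θ g (suc n) + (w + fg n)) (θ-⊛ (f ∘ suc) g n) ⟩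
    f 0 * θ g (suc n) + (((θ (f ∘ suc) ⊛ g) n + ((f ∘ suc) ⊛ θ g) n) + fg n)
      ≡⟨ solve 6 (λ x a b c u y → x :+ ((a :+ b) :+ c) := (con 0ℚ :* u :* y :+ (a :+ c)) :+ (x :+ b)) refl
          (f 0 * θ g (suc n)) ((θ (f ∘ suc) ⊛ g) n) (((f ∘ suc) ⊛ θ g) n) (fg n) (f 0) (g (suc n)) ⟩
    (0ℚ * f 0 * g (suc n) + ((θ (f ∘ suc) ⊛ g) n + fg n)) + (f ⊛ θ g) (suc n)
      ≡⟨ cong (λ w → (0ℚ * f 0 * g (suc n) + w) + (f ⊛ θ g) (suc n))
          (sym (trans (⊛-congʳ g (θ-tail f) n) (⊛-distribʳ g (θ (f ∘ suc)) (f ∘ suc) n))) ⟩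
    (θ f ⊛ g) (suc n) + (f ⊛ θ g) (suc n) ∎
    where
    fg : Series
    fg = (f ∘ suc) ⊛ g

  -- Newton's identities

  neg1^ : ℕ → ℚ
  neg1^ k = (- 1ℚ) ^^ k

  -- The coefficients of the polynomial Π (1 - x X), x running over the list.
  signedElemSym : List ℕ → Series
  signedElemSym xs k = neg1^ k * ℕ→ℚ (elemSym k xs)

  positivePowers : ℕ → Series
  positivePowers x zero    = 0ℚ
  positivePowers x (suc k) = ℕ→ℚ x ^^ suc k

  -- The value at 0 is 0, not the number of entries.
  powerSums : List ℕ → Series
  powerSums []       = 𝟘
  powerSums (x ∷ xs) = positivePowers x ⊕ powerSums xs

  powerSums-++ : ∀ xs ys → powerSums (xs ++ ys) ≗ powerSums xs ⊕ powerSums ys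
  powerSums-++ []       ys k = sym (+-identityˡ (powerSums ys k))
  powerSums-++ (x ∷ xs) ys k = trans (cong (_+_ (positivePowers x k)) (powerSums-++ xs ys k))
    (sym (+-assoc (positivePowers x k) (powerSums xs k) (powerSums ys k)))

  linearFactor : ℕ → Series
  linearFactor x = monomial 1ℚ 0 ⊕ monomial (- ℕ→ℚ x) 1

  linearFactor-⊛-suc : ∀ x f k → (linearFactor x ⊛ f) (suc k) ≡ f (suc k) - ℕ→ℚ x * f k
  linearFactor-⊛-suc x f k = trans (⊛-distribʳ f (monomial 1ℚ 0) (monomial (- ℕ→ℚ x) 1) (suc k))
    (trans (cong₂ _+_ (monomial0-⊛ 1ℚ f (suc k)) (monomial1-⊛-suc (- ℕ→ℚ x) f k))
      (solve 3 (λ a x b → con 1ℚ :* a :+ (:- x) :* b := a :- x :* b) refl (f (suc k)) (ℕ→ℚ x) (f k)))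

  signedElemSym-∷ : ∀ x xs → signedElemSym (x ∷ xs) ≗ linearFactor x ⊛ signedElemSym xs
  signedElemSym-∷ x xs zero    = refl
  signedElemSym-∷ x xs (suc k) = trans (cong (neg1^ (suc k) *_)
      (trans (ℕ→ℚ-+ (x ℕ.* elemSym k xs) (elemSym (suc k) xs)) (cong (_+ ℕ→ℚ (elemSym (suc k) xs)) (ℕ→ℚ-* x (elemSym k xs)))))
    (trans (solve 4 (λ s x a b → (con (- 1ℚ) :* s) :* (x :* a :+ b) := (con (- 1ℚ) :* s) :* b :- x :* (s :* a)) refl
       (neg1^ k) (ℕ→ℚ x) (ℕ→ℚ (elemSym k xs)) (ℕ→ℚ (elemSym (suc k) xs)))
     (sym (linearFactor-⊛-suc x (signedElemSym xs) k)))

  signedElemSym-[] : signedElemSym [] ≗ monomial 1ℚ 0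
  signedElemSym-[] zero    = refl
  signedElemSym-[] (suc k) = *-zeroʳ (neg1^ (suc k))

  -- Geometric series: `positivePowers x` is x X / (1 - x X).
  linearFactor-⊛-positivePowers : ∀ x → linearFactor x ⊛ positivePowers x ≗ monomial (ℕ→ℚ x) 1
  linearFactor-⊛-positivePowers x zero          = refl
  linearFactor-⊛-positivePowers x (suc zero)    = trans (linearFactor-⊛-suc x (positivePowers x) 0)
    (solve 1 (λ x → x :* con 1ℚ :- x :* con 0ℚ := x) refl (ℕ→ℚ x))
  linearFactor-⊛-positivePowers x (suc (suc k)) = trans (linearFactor-⊛-suc x (positivePowers x) (suc k))
    (+-inverseʳ (ℕ→ℚ x * positivePowers x (suc k)))

  θ-linearFactor : ∀ x → θ (linearFactor x) ≗ (- 1ℚ) ⋆ monomial (ℕ→ℚ x) 1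
  θ-linearFactor x zero          = refl
  θ-linearFactor x (suc zero)    = solve 1 (λ x → con 1ℚ :* (con 0ℚ :+ (:- x)) := con (- 1ℚ) :* x) refl (ℕ→ℚ x)
  θ-linearFactor x (suc (suc k)) = *-zeroʳ (ℕ→ℚ (suc (suc k)))

  -- Logarithmic derivative of a product: `θ` of a factor 1 - x X is minus that factor times x X /
  -- (1 - x X), and by the Leibniz rule these geometric series add up to the power sums.
  newton : ∀ xs → θ (signedElemSym xs) ≗ (- 1ℚ) ⋆ (signedElemSym xs ⊛ powerSums xs)
  newton [] n = trans (trans (cong (ℕ→ℚ n *_) (signedElemSym-[] n)) (θ-one n))
    (sym (cong (- 1ℚ *_) (trans (⊛-comm (signedElemSym []) 𝟘 n) (⊛-zeroˡ (signedElemSym []) n))))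
    where
    θ-one : θ (monomial 1ℚ 0) ≗ 𝟘
    θ-one zero    = refl
    θ-one (suc n) = *-zeroʳ (ℕ→ℚ (suc n))
  newton (x ∷ xs) n = begin
    θ (signedElemSym (x ∷ xs)) n
      ≡⟨ cong (ℕ→ℚ n *_) (signedElemSym-∷ x xs n) ⟩
    θ (L ⊛ s) n
      ≡⟨ θ-⊛ L s n ⟩
    (θ L ⊛ s) n + (L ⊛ θ s) n
      ≡⟨ cong₂ _+_ (trans (⊛-congʳ s θL n) (⋆-⊛ (- 1ℚ) (L ⊛ q) s n))
                   (trans (⊛-congˡ L (newton xs) n) (⊛-⋆ (- 1ℚ) L (s ⊛ S) n)) ⟩
    - 1ℚ * ((L ⊛ q) ⊛ s) n + - 1ℚ * (L ⊛ (s ⊛ S)) n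
      ≡⟨ sym (*-distribˡ-+ (- 1ℚ) (((L ⊛ q) ⊛ s) n) ((L ⊛ (s ⊛ S)) n)) ⟩
    - 1ℚ * (((L ⊛ q) ⊛ s) n + (L ⊛ (s ⊛ S)) n)
      ≡⟨ cong (- 1ℚ *_) (rearrange L s q S n) ⟩
    - 1ℚ * ((L ⊛ s) ⊛ (q ⊕ S)) n
      ≡⟨ cong (- 1ℚ *_) (sym (⊛-congʳ (q ⊕ S) (signedElemSym-∷ x xs) n)) ⟩
    - 1ℚ * (signedElemSym (x ∷ xs) ⊛ powerSums (x ∷ xs)) n ∎
    where
    L s q S : Series
    L = linearFactor x
    s = signedElemSym xs
    q = positivePowers x
    S = powerSums xs
    θL : θ L ≗ (- 1ℚ) ⋆ (L ⊛ q)
    θL k = trans (θ-linearFactor x k) (cong (- 1ℚ *_) (sym (linearFactor-⊛-positivePowers x k)))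
    rearrange : ∀ L s q S → (L ⊛ q) ⊛ s ⊕ L ⊛ (s ⊛ S) ≗ (L ⊛ s) ⊛ (q ⊕ S)
    rearrange = SeriesSolver.solve 4 (λ L s q S → (L ⊗ q) ⊗ s ⊞ L ⊗ (s ⊗ S) ⊜ (L ⊗ s) ⊗ (q ⊞ S)) λ _ → refl
      where open SeriesSolver renaming (_:+_ to _⊞_; _:*_ to _⊗_; _:=_ to _⊜_)

  -- Bernoulli numbers and Faulhaber's formula

  -- umbral x k a is "(x + a)^k" with a^j read as a j, i.e. Σ_j C(k,j) a_j x^(k-j).
  umbral : ℚ → ℕ → Series → ℚ
  umbral x zero    a = a 0
  umbral x (suc k) a = x * umbral x k a + umbral x k (a ∘ suc)

  umbral-cong : ∀ x k {a b} → a ≗ b → umbral x k a ≡ umbral x k b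
  umbral-cong x zero    e = e 0
  umbral-cong x (suc k) e = cong₂ (λ u v → x * u + v) (umbral-cong x k e) (umbral-cong x k (e ∘ suc))

  umbral-linear : ∀ x k c a b → umbral x k (a ⊕ c ⋆ b) ≡ umbral x k a + c * umbral x k b
  umbral-linear x zero    c a b = refl
  umbral-linear x (suc k) c a b =
    trans (cong₂ (λ u v → x * u + v) (umbral-linear x k c a b) (umbral-linear x k c (a ∘ suc) (b ∘ suc)))
      (solve 6 (λ x c u v w z → x :* (u :+ c :* v) :+ (w :+ c :* z) := (x :* u :+ w) :+ c :* (x :* v :+ z)) refl
        x c (umbral x k a) (umbral x k b) (umbral x k (a ∘ suc)) (umbral x k (b ∘ suc)))

  umbral-+ : ∀ x y k a → umbral y k (λ j → umbral x j a) ≡ umbral (x + y) k a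
  umbral-+ x y zero    a = refl
  umbral-+ x y (suc k) a = trans (cong₂ (λ u v → y * u + v) (umbral-+ x y k a)
      (trans (umbral-cong y k λ j → +-comm (x * umbral x j a) (umbral x j (a ∘ suc)))
      (trans (umbral-linear y k x (λ j → umbral x j (a ∘ suc)) (λ j → umbral x j a))
        (cong₂ (λ u v → u + x * v) (umbral-+ x y k (a ∘ suc)) (umbral-+ x y k a)))))
    (solve 4 (λ x y u v → y :* u :+ (v :+ x :* u) := (x :+ y) :* u :+ v) refl
      x y (umbral (x + y) k a) (umbral (x + y) k (a ∘ suc)))

  umbral-0 : ∀ k a → umbral 0ℚ k a ≡ a k
  umbral-0 zero    a = refl
  umbral-0 (suc k) a = trans (cong₂ _+_ (*-zeroˡ (umbral 0ℚ k a)) (umbral-0 k (a ∘ suc))) (+-identityˡ (a (suc k)))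

  umbral-𝟘 : ∀ x k → umbral x k 𝟘 ≡ 0ℚ
  umbral-𝟘 x zero    = refl
  umbral-𝟘 x (suc k) = trans (cong₂ (λ u v → x * u + v) (umbral-𝟘 x k) (umbral-𝟘 x k))
    (trans (+-identityʳ (x * 0ℚ)) (*-zeroʳ x))

  umbral-neg : ∀ x k a → umbral x k (λ j → neg1^ j * a j) ≡ neg1^ k * umbral (- x) k a
  umbral-neg x zero    a = refl
  umbral-neg x (suc k) a = trans
    (cong₂ (λ u v → x * u + v) (umbral-neg x k a)
      (trans (umbral-cong x k (λ j → solve 2 (λ s a → (con (- 1ℚ) :* s) :* a := con 0ℚ :+ con (- 1ℚ) :* (s :* a)) refl (neg1^ j) (a (suc j))))
      (trans (umbral-linear x k (- 1ℚ) 𝟘 (λ j → neg1^ j * a (suc j)))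
             (cong₂ (λ u v → u + - 1ℚ * v) (umbral-𝟘 x k) (umbral-neg x k (a ∘ suc))))))
    (solve 4 (λ x s u v → x :* (s :* u) :+ (con 0ℚ :+ con (- 1ℚ) :* (s :* v)) := con (- 1ℚ) :* s :* ((:- x) :* u :+ v)) refl
      x (neg1^ k) (umbral (- x) k a) (umbral (- x) k (a ∘ suc)))

  umbral-δ₀ : ∀ x k → umbral x k (monomial 1ℚ 0) ≡ x ^^ k
  umbral-δ₀ x zero    = refl
  umbral-δ₀ x (suc k) = trans (cong₂ (λ u v → x * u + v) (umbral-δ₀ x k) (umbral-𝟘 x k)) (+-identityʳ (x * x ^^ k))

  umbral-δ₁ : ∀ x k → umbral x (suc k) (monomial 1ℚ 1) ≡ ℕ→ℚ (suc k) * x ^^ k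
  umbral-δ₁ x zero    = solve 1 (λ x → x :* con 0ℚ :+ con 1ℚ := con 1ℚ :* con 1ℚ) refl x
  umbral-δ₁ x (suc k) = trans (cong₂ (λ u v → x * u + v) (umbral-δ₁ x k) (umbral-δ₀ x (suc k)))
    (trans (solve 3 (λ x m u → x :* (m :* u) :+ x :* u := (con 1ℚ :+ m) :* (x :* u)) refl x (ℕ→ℚ (suc k)) (x ^^ k))
      (cong (_* x ^^ suc k) (sym (ℕ→ℚ-suc (suc k)))))

  -- taylor r x k a collects the terms of umbral x k a of degree less than r in x.
  taylor : ℕ → ℚ → ℕ → Series → ℚ
  taylor zero    x k       a = 0ℚ
  taylor (suc r) x zero    a = a 0
  taylor (suc r) x (suc k) a = x * taylor r x k a + taylor (suc r) x k (a ∘ suc)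

  -- The cofactor of x^r in the terms of degree at least r, built without any division.
  remainder : ℕ → ℚ → ℕ → Series → ℚ
  remainder zero    x k       a = umbral x k a
  remainder (suc r) x zero    a = 0ℚ
  remainder (suc r) x (suc k) a = remainder r x k a + remainder (suc r) x k (a ∘ suc)

  umbral-taylor : ∀ r x k a → umbral x k a ≡ taylor r x k a + x ^^ r * remainder r x k a
  umbral-taylor zero    x k       a = solve 1 (λ u → u := con 0ℚ :+ con 1ℚ :* u) refl (umbral x k a)
  umbral-taylor (suc r) x zero    a = solve 2 (λ u x → u := u :+ x :* con 0ℚ) refl (a 0) (x ^^ suc r)
  umbral-taylor (suc r) x (suc k) a = trans
    (cong₂ (λ u v → x * u + v) (umbral-taylor r x k a) (umbral-taylor (suc r) x k (a ∘ suc)))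
    (solve 6 (λ x t y R t′ R′ → x :* (t :+ y :* R) :+ (t′ :+ x :* y :* R′) := (x :* t :+ t′) :+ x :* y :* (R :+ R′)) refl
      x (taylor r x k a) (x ^^ r) (remainder r x k a) (taylor (suc r) x k (a ∘ suc)) (remainder (suc r) x k (a ∘ suc)))

  -- Only entries `a j` with j + r ≤ k occur in the remainder. With p-integrality as `Q`, this bound
  -- keeps Bernoulli numbers with p in the denominator out of the error terms; with `_≡ 0ℚ` it
  -- serves the uniqueness of the Bernoulli recurrence.
  remainder-closed : ∀ (Q : ℚ → Set) x → Q 0ℚ → (∀ {u v} → Q u → Q v → Q (u + v)) → (∀ {u} → Q u → Q (x * u)) →
    ∀ r k a → (∀ j → j ℕ.+ r ℕ.≤ k → Q (a j)) → Q (remainder r x k a)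
  remainder-closed Q x Q0 Q+ Q* = go
    where
    go : ∀ r k a → (∀ j → j ℕ.+ r ℕ.≤ k → Q (a j)) → Q (remainder r x k a)
    go zero    zero    a h = h 0 z≤n
    go zero    (suc k) a h = Q+ (Q* (go zero k a λ j le → h j (ℕ.m≤n⇒m≤1+n le))) (go zero k (a ∘ suc) λ j le → h (suc j) (s≤s le))
    go (suc r) zero    a h = Q0
    go (suc r) (suc k) a h = Q+ (go r k a λ j le → h j (subst (ℕ._≤ suc k) (sym (ℕ.+-suc j r)) (s≤s le)))
                                (go (suc r) k (a ∘ suc) λ j le → h (suc j) (s≤s le))

  taylor-1 : ∀ x k a → taylor 1 x k a ≡ a k
  taylor-1 x zero    a = refl
  taylor-1 x (suc k) a = trans (cong₂ _+_ (*-zeroʳ x) (taylor-1 x k (a ∘ suc))) (+-identityˡ (a (suc k)))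

  taylor-saturated : ∀ r x k a → k ℕ.< r → taylor (suc r) x k a ≡ taylor r x k a
  taylor-saturated (suc r) x zero    a _       = refl
  taylor-saturated (suc r) x (suc k) a (s≤s lt) =
    cong₂ (λ u v → x * u + v) (taylor-saturated r x k a lt) (taylor-saturated (suc r) x k (a ∘ suc) (ℕ.m<n⇒m<1+n lt))

  -- binom r k is the binomial coefficient C(r + k, r).
  binom : ℕ → ℕ → ℚ
  binom r       zero    = 1ℚ
  binom zero    (suc k) = 1ℚ
  binom (suc r) (suc k) = binom r (suc k) + binom (suc r) k

  taylor-suc : ∀ r x k a → taylor (suc r) x (r ℕ.+ k) a ≡ taylor r x (r ℕ.+ k) a + binom r k * (x ^^ r * a k)
  taylor-suc zero    x k       a = trans (taylor-1 x k a)
    (trans (solve 1 (λ u → u := con 0ℚ :+ con 1ℚ :* (con 1ℚ :* u)) refl (a k)) (cong (λ c → 0ℚ + c * (1ℚ * a k)) (sym (binom-0 k))))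
    where
    binom-0 : ∀ k → binom 0 k ≡ 1ℚ
    binom-0 zero    = refl
    binom-0 (suc k) = refl
  taylor-suc (suc r) x zero    a = trans
    (cong₂ (λ u v → x * u + v) (taylor-suc r x zero a)
      (taylor-saturated (suc r) x (r ℕ.+ 0) (a ∘ suc) (s≤s (ℕ.≤-reflexive (ℕ.+-identityʳ r)))))
    (solve 5 (λ x t y u v → x :* (t :+ con 1ℚ :* (y :* u)) :+ v := (x :* t :+ v) :+ con 1ℚ :* (x :* y :* u)) refl
      x (taylor r x (r ℕ.+ 0) a) (x ^^ r) (a 0) (taylor (suc r) x (r ℕ.+ 0) (a ∘ suc)))
  taylor-suc (suc r) x (suc k) a = trans
    (cong₂ (λ u v → x * u + v) (taylor-suc r x (suc k) a)
      (subst (λ n → taylor (suc (suc r)) x n (a ∘ suc) ≡ taylor (suc r) x n (a ∘ suc) + binom (suc r) k * (x ^^ suc r * a (suc k)))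
        (sym (ℕ.+-suc r k)) (taylor-suc (suc r) x k (a ∘ suc))))
    (solve 7 (λ x t c y u v d → x :* (t :+ c :* (y :* u)) :+ (v :+ d :* (x :* y :* u)) := (x :* t :+ v) :+ (c :+ d) :* (x :* y :* u)) refl
      x (taylor r x (r ℕ.+ suc k) a) (binom r (suc k)) (x ^^ r) (a (suc k)) (taylor (suc r) x (r ℕ.+ suc k) (a ∘ suc)) (binom (suc r) k))

  binom-1 : ∀ k → binom 1 k ≡ 1ℚ + ℕ→ℚ k
  binom-1 zero    = refl
  binom-1 (suc k) = trans (cong (_+_ 1ℚ) (binom-1 k)) (cong (_+_ 1ℚ) (sym (ℕ→ℚ-suc k)))

  binom-2 : ∀ k → binom 2 k ≡ (+ 1 / 2) * ((1ℚ + ℕ→ℚ k) * (1ℚ + (1ℚ + ℕ→ℚ k)))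
  binom-2 zero    = refl
  binom-2 (suc k) = trans (cong₂ _+_ (trans (binom-1 (suc k)) (cong (_+_ 1ℚ) (ℕ→ℚ-suc k))) (binom-2 k))
    (trans (solve 1 (λ m → (con 1ℚ :+ (con 1ℚ :+ m)) :+ con (+ 1 / 2) :* ((con 1ℚ :+ m) :* (con 1ℚ :+ (con 1ℚ :+ m)))
                        := con (+ 1 / 2) :* ((con 1ℚ :+ (con 1ℚ :+ m)) :* (con 1ℚ :+ (con 1ℚ :+ (con 1ℚ :+ m))))) refl (ℕ→ℚ k))
      (cong (λ m → (+ 1 / 2) * ((1ℚ + m) * (1ℚ + (1ℚ + m)))) (sym (ℕ→ℚ-suc k))))

  binom-3 : ∀ k → binom 3 k ≡ (+ 1 / 6) * ((1ℚ + ℕ→ℚ k) * ((1ℚ + (1ℚ + ℕ→ℚ k)) * (1ℚ + (1ℚ + (1ℚ + ℕ→ℚ k)))))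
  binom-3 zero    = refl
  binom-3 (suc k) = trans (cong₂ _+_ (trans (binom-2 (suc k)) (cong (λ m → (+ 1 / 2) * ((1ℚ + m) * (1ℚ + (1ℚ + m)))) (ℕ→ℚ-suc k))) (binom-3 k))
    (trans (solve 1 (λ m → con (+ 1 / 2) :* ((con 1ℚ :+ (con 1ℚ :+ m)) :* (con 1ℚ :+ (con 1ℚ :+ (con 1ℚ :+ m))))
                           :+ con (+ 1 / 6) :* ((con 1ℚ :+ m) :* ((con 1ℚ :+ (con 1ℚ :+ m)) :* (con 1ℚ :+ (con 1ℚ :+ (con 1ℚ :+ m)))))
                        := con (+ 1 / 6) :* ((con 1ℚ :+ (con 1ℚ :+ m)) :* ((con 1ℚ :+ (con 1ℚ :+ (con 1ℚ :+ m))) :* (con 1ℚ :+ (con 1ℚ :+ (con 1ℚ :+ (con 1ℚ :+ m))))))) refl (ℕ→ℚ k))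
      (cong (λ m → (+ 1 / 6) * ((1ℚ + m) * ((1ℚ + (1ℚ + m)) * (1ℚ + (1ℚ + (1ℚ + m)))))) (sym (ℕ→ℚ-suc k))))

  1^^ : ∀ k → 1ℚ ^^ k ≡ 1ℚ
  1^^ zero    = refl
  1^^ (suc k) = trans (*-identityˡ (1ℚ ^^ k)) (1^^ k)

  neg1^-square : ∀ k → neg1^ k * neg1^ k ≡ 1ℚ
  neg1^-square zero    = refl
  neg1^-square (suc k) = trans (solve 1 (λ s → (con (- 1ℚ) :* s) :* (con (- 1ℚ) :* s) := s :* s) refl (neg1^ k)) (neg1^-square k)

  -- At exponent k + 1 the terms of degree 0 in x cancel, those of degree 1 give (k + 1) d_k, and
  -- all others involve earlier entries, which are 0 by induction.
  umbral-fixed⇒0 : ∀ d → (∀ k → umbral 1ℚ k d ≡ d k) → d ≗ 𝟘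
  umbral-fixed⇒0 d fix = <-rec (λ k → d k ≡ 0ℚ) λ k ih → *-cancel-suc k (begin
    ℕ→ℚ (suc k) * d k
      ≡⟨ cong (_* d k) (trans (ℕ→ℚ-suc k) (sym (binom-1 k))) ⟩
    binom 1 k * d k
      ≡⟨ solve 4 (λ c u v w → c :* u := (((v :+ c :* (con 1ℚ :* u)) :+ w :* con 0ℚ) :- v)) refl (binom 1 k) (d k) (d (suc k)) (1ℚ ^^ 2) ⟩
    ((d (suc k) + binom 1 k * (1ℚ * d k)) + 1ℚ ^^ 2 * 0ℚ) - d (suc k)
      ≡⟨ cong₂ (λ t r → (t + 1ℚ ^^ 2 * r) - d (suc k))
           (sym (trans (taylor-suc 1 1ℚ k d) (cong (_+ binom 1 k * (1ℚ * d k)) (taylor-1 1ℚ (suc k) d))))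
           (sym (remainder-closed (_≡ 0ℚ) 1ℚ refl (λ e e′ → cong₂ _+_ e e′) (λ e → cong (1ℚ *_) e) 2 (suc k) d
                  (λ j le → ih (ℕ.s≤s⁻¹ (subst (ℕ._≤ suc k) (ℕ.+-comm j 2) le))))) ⟩
    (taylor 2 1ℚ (suc k) d + 1ℚ ^^ 2 * remainder 2 1ℚ (suc k) d) - d (suc k)
      ≡⟨ cong (_- d (suc k)) (sym (umbral-taylor 2 1ℚ (suc k) d)) ⟩
    umbral 1ℚ (suc k) d - d (suc k)
      ≡⟨ cong (_- d (suc k)) (fix (suc k)) ⟩
    d (suc k) - d (suc k)
      ≡⟨ +-inverseʳ (d (suc k)) ⟩
    0ℚ
      ≡⟨ sym (*-zeroʳ (ℕ→ℚ (suc k))) ⟩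
    ℕ→ℚ (suc k) * 0ℚ ∎)

  module Bernoulli (b : ℕ → ℚ) (recurrence : ∀ k → umbral 1ℚ k b ≡ b k + monomial 1ℚ 1 k) where

    private
      recurrence′ : (λ k → umbral 1ℚ k b) ≗ b ⊕ 1ℚ ⋆ monomial 1ℚ 1
      recurrence′ k = trans (recurrence k) (cong (_+_ (b k)) (sym (*-identityˡ (monomial 1ℚ 1 k))))

    -- `umbral x k b` is the Bernoulli polynomial B_k(x). The recurrence is its difference equation
    -- at 0, and `umbral-+` translates it to every x.
    umbral-1+ : ∀ x k → umbral (1ℚ + x) k b ≡ umbral x k b + umbral x k (monomial 1ℚ 1)
    umbral-1+ x k = begin
      umbral (1ℚ + x) k b                                  ≡⟨ sym (umbral-+ 1ℚ x k b) ⟩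
      umbral x k (λ j → umbral 1ℚ j b)                     ≡⟨ umbral-cong x k recurrence′ ⟩
      umbral x k (b ⊕ 1ℚ ⋆ monomial 1ℚ 1)                  ≡⟨ umbral-linear x k 1ℚ b (monomial 1ℚ 1) ⟩
      umbral x k b + 1ℚ * umbral x k (monomial 1ℚ 1)       ≡⟨ cong (_+_ (umbral x k b)) (*-identityˡ _) ⟩
      umbral x k b + umbral x k (monomial 1ℚ 1) ∎

    -- Telescopes the difference equation from 1 to m + 1. The initial value at 1 is `b (2 ℕ.+ k)`
    -- because the exponent exceeds 1.
    faulhaber : ∀ m k → umbral (ℕ→ℚ (suc m)) (2 ℕ.+ k) b ≡ b (2 ℕ.+ k) + ℕ→ℚ (2 ℕ.+ k) * powerSums (range1 m) (suc k)
    faulhaber zero    k = trans (recurrence (2 ℕ.+ k)) (cong (_+_ (b (2 ℕ.+ k))) (sym (*-zeroʳ (ℕ→ℚ (2 ℕ.+ k)))))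
    faulhaber (suc m) k = begin
      umbral (ℕ→ℚ (2 ℕ.+ m)) (2 ℕ.+ k) b
        ≡⟨ cong (λ x → umbral x (2 ℕ.+ k) b) (ℕ→ℚ-suc (suc m)) ⟩
      umbral (1ℚ + N) (2 ℕ.+ k) b
        ≡⟨ umbral-1+ N (2 ℕ.+ k) ⟩
      umbral N (2 ℕ.+ k) b + umbral N (2 ℕ.+ k) (monomial 1ℚ 1)
        ≡⟨ cong₂ _+_ (faulhaber m k) (umbral-δ₁ N (suc k)) ⟩
      (b (2 ℕ.+ k) + K * powerSums (range1 m) (suc k)) + K * N ^^ suc k
        ≡⟨ solve 4 (λ u K s t → (u :+ K :* s) :+ K :* t := u :+ K :* (s :+ (t :+ con 0ℚ))) refl (b (2 ℕ.+ k)) K (powerSums (range1 m) (suc k)) (N ^^ suc k) ⟩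
      b (2 ℕ.+ k) + K * (powerSums (range1 m) (suc k) + (N ^^ suc k + 0ℚ))
        ≡⟨ cong (λ s → b (2 ℕ.+ k) + K * s) (sym (powerSums-++ (range1 m) (suc m ∷ []) (suc k))) ⟩
      b (2 ℕ.+ k) + K * powerSums (range1 (suc m)) (suc k) ∎
      where
      N K : ℚ
      N = ℕ→ℚ (suc m)
      K = ℕ→ℚ (2 ℕ.+ k)

    private
      twisted : Series
      twisted k = neg1^ k * b k

      neg1^-umbral-δ₁ : ∀ k → neg1^ k * umbral (- 1ℚ) k (monomial 1ℚ 1) ≡ - ℕ→ℚ k
      neg1^-umbral-δ₁ zero    = refl
      neg1^-umbral-δ₁ (suc k) = begin
        neg1^ (suc k) * umbral (- 1ℚ) (suc k) (monomial 1ℚ 1)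
          ≡⟨ cong (neg1^ (suc k) *_) (umbral-δ₁ (- 1ℚ) k) ⟩
        - 1ℚ * neg1^ k * (ℕ→ℚ (suc k) * neg1^ k)
          ≡⟨ solve 2 (λ s m → con (- 1ℚ) :* s :* (m :* s) := (:- m) :* (s :* s)) refl (neg1^ k) (ℕ→ℚ (suc k)) ⟩
        - ℕ→ℚ (suc k) * (neg1^ k * neg1^ k)
          ≡⟨ cong (- ℕ→ℚ (suc k) *_) (neg1^-square k) ⟩
        - ℕ→ℚ (suc k) * 1ℚ
          ≡⟨ *-identityʳ (- ℕ→ℚ (suc k)) ⟩
        - ℕ→ℚ (suc k) ∎

      -- The sign twist turns the argument 1 into -1, and the difference equation at -1 leads to
      -- `umbral 0ℚ k b`, which is `b k`.
      umbral-twisted : ∀ k → umbral 1ℚ k twisted ≡ twisted k + ℕ→ℚ k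
      umbral-twisted k = begin
        umbral 1ℚ k twisted
          ≡⟨ umbral-neg 1ℚ k b ⟩
        s * u
          ≡⟨ solve 3 (λ s u v → s :* u := s :* (u :+ v) :- s :* v) refl s u v ⟩
        s * (u + v) - s * v
          ≡⟨ cong₂ (λ x y → s * x - y) (trans (sym (umbral-1+ (- 1ℚ) k)) (umbral-0 k b)) (neg1^-umbral-δ₁ k) ⟩
        s * b k - (- ℕ→ℚ k)
          ≡⟨ solve 2 (λ x m → x :- (:- m) := x :+ m) refl (s * b k) (ℕ→ℚ k) ⟩
        s * b k + ℕ→ℚ k ∎
        where
        s u v : ℚ
        s = neg1^ k
        u = umbral (- 1ℚ) k b
        v = umbral (- 1ℚ) k (monomial 1ℚ 1)

      umbral-1-δ₁ : ∀ k → umbral 1ℚ k (monomial 1ℚ 1) ≡ ℕ→ℚ k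
      umbral-1-δ₁ zero    = refl
      umbral-1-δ₁ (suc k) = trans (umbral-δ₁ 1ℚ k) (trans (cong (ℕ→ℚ (suc k) *_) (1^^ k)) (*-identityʳ (ℕ→ℚ (suc k))))

    -- Both (-1)^k B_k - [k = 1] and B_k satisfy the Bernoulli recurrence, which has only one solution.
    reflection : ∀ k → neg1^ k * b k ≡ b k + monomial 1ℚ 1 k
    reflection k = begin
      twisted k
        ≡⟨ solve 3 (λ t u v → t := u :+ v :+ ((t :+ con (- 1ℚ) :* v) :+ con (- 1ℚ) :* u)) refl (twisted k) (b k) (monomial 1ℚ 1 k) ⟩
      b k + monomial 1ℚ 1 k + ((twisted ⊕ (- 1ℚ) ⋆ monomial 1ℚ 1) ⊕ (- 1ℚ) ⋆ b) k
        ≡⟨ cong (_+_ (b k + monomial 1ℚ 1 k)) (umbral-fixed⇒0 _ fixed k) ⟩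
      b k + monomial 1ℚ 1 k + 0ℚ
        ≡⟨ +-identityʳ (b k + monomial 1ℚ 1 k) ⟩
      b k + monomial 1ℚ 1 k ∎
      where
      fixed : ∀ k → umbral 1ℚ k ((twisted ⊕ (- 1ℚ) ⋆ monomial 1ℚ 1) ⊕ (- 1ℚ) ⋆ b) ≡ ((twisted ⊕ (- 1ℚ) ⋆ monomial 1ℚ 1) ⊕ (- 1ℚ) ⋆ b) k
      fixed k = trans (umbral-linear 1ℚ k (- 1ℚ) (twisted ⊕ (- 1ℚ) ⋆ monomial 1ℚ 1) b)
        (trans (cong (_+ - 1ℚ * umbral 1ℚ k b) (umbral-linear 1ℚ k (- 1ℚ) twisted (monomial 1ℚ 1)))
        (trans (cong₂ (λ u v → u + - 1ℚ * v) (cong₂ (λ u v → u + - 1ℚ * v) (umbral-twisted k) (umbral-1-δ₁ k)) (recurrence k))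
          (solve 4 (λ t m u v → ((t :+ m) :+ con (- 1ℚ) :* m) :+ con (- 1ℚ) :* (u :+ v) := (t :+ con (- 1ℚ) :* v) :+ con (- 1ℚ) :* u) refl
            (twisted k) (ℕ→ℚ k) (b k) (monomial 1ℚ 1 k))))

  -- The Bernoulli numbers of the statement satisfy the umbral recurrence

  dot : (ℕ → ℚ) → ℕ → List ℚ → ℚ
  dot w k []       = 0ℚ
  dot w k (x ∷ xs) = w k * x + dot w (suc k) xs

  opaque
    bernoulliWeight : ℕ → ℕ → ℚ
    bernoulliWeight m k = ℕ→ℚ (suc (suc m) C k)

    bernoulliWeight-def : ∀ m k → bernoulliWeight m k ≡ ℕ→ℚ (suc (suc m) C k)
    bernoulliWeight-def m k = refl

  -- The local function of nextB occurs in its unfolding with some arguments repeated; the with-abstraction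
  -- makes them distinct variables, so that unification can fill in the _ in go-dot with that function.
  -- It is well-typed only because bernoulliWeight is opaque, so that no further 1 is abstracted inside the weights.
  mutual
    nextB-∷ : ∀ m x xs (D : ℕ → ℚ) → (∀ k → D k ≡ dot (bernoulliWeight m) k xs) →
      nextB (suc m) (x ∷ xs) ≡ - ((+ 1 / suc (suc m)) * (ℕ→ℚ (suc (suc m) C 0) * x + D 1))
    nextB-∷ m x xs D e with x ∷ xs | + 1 / suc (suc m) | ℕ→ℚ (suc (suc m) C 0)
    ... | ys | q | c with 1
    ...   | k = cong (λ s → - (q * (c * x + s))) (trans (go-dot m ys k xs) (sym (e k)))

    go-dot : ∀ m (ys : List ℚ) k xs → _ ≡ dot (bernoulliWeight m) k xs
    go-dot m ys k []       = refl
    go-dot m ys k (x ∷ xs) = cong₂ (λ c s → c * x + s) (sym (bernoulliWeight-def m k)) (go-dot m ys (suc k) xs)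

  nextB-dot : ∀ m xs → nextB (suc m) xs ≡ - ((+ 1 / suc (suc m)) * dot (bernoulliWeight m) 0 xs)
  nextB-dot m []       = refl
  nextB-dot m (x ∷ xs) = trans (nextB-∷ m x xs (λ k → dot (bernoulliWeight m) k xs) (λ _ → refl))
    (cong (λ c → - ((+ 1 / suc (suc m)) * (c * x + dot (bernoulliWeight m) 1 xs))) (sym (bernoulliWeight-def m 0)))

  sumTo : ℕ → (ℕ → ℚ) → ℕ → ℚ
  sumTo zero    f i = 0ℚ
  sumTo (suc k) f i = f i + sumTo k f (suc i)

  mutual
    -- The device of `nextB-∷` again: the local function of `sumFromTo` has no name here, and
    -- abstracting `suc a` to a variable lets unification find it for the `_` in `go-sumTo`.
    sumFromTo-sumTo : ∀ a b f → sumFromTo a b f ≡ sumTo (suc b ℕ.∸ a) f a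
    sumFromTo-sumTo a b f with suc b ℕ.∸ a
    ... | zero  = refl
    ... | suc k with suc a
    ...   | i = cong (_+_ (f a)) (go-sumTo a b f k i)

    go-sumTo : ∀ (a b : ℕ) f k i → _ ≡ sumTo k f i
    go-sumTo a b f zero    i = refl
    go-sumTo a b f (suc k) i = cong (_+_ (f i)) (go-sumTo a b f k (suc i))

  Σ< : ℕ → (ℕ → ℚ) → ℚ
  Σ< zero    f = 0ℚ
  Σ< (suc n) f = Σ< n f + f n

  Σ<-suc : ∀ n f → Σ< (suc n) f ≡ f 0 + Σ< n (f ∘ suc)
  Σ<-suc zero    f = +-comm 0ℚ (f 0)
  Σ<-suc (suc n) f = trans (cong (_+ f (suc n)) (Σ<-suc n f)) (+-assoc (f 0) (Σ< n (f ∘ suc)) (f (suc n)))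

  Σ<-cong : ∀ n {f g} → f ≗ g → Σ< n f ≡ Σ< n g
  Σ<-cong zero    e = refl
  Σ<-cong (suc n) e = cong₂ _+_ (Σ<-cong n e) (e n)

  Σ<-+ : ∀ n f g → Σ< n (f ⊕ g) ≡ Σ< n f + Σ< n g
  Σ<-+ zero    f g = refl
  Σ<-+ (suc n) f g = trans (cong (_+ (f n + g n)) (Σ<-+ n f g))
    (solve 4 (λ a b c d → (a :+ b) :+ (c :+ d) := (a :+ c) :+ (b :+ d)) refl (Σ< n f) (Σ< n g) (f n) (g n))

  umbral-1 : ∀ k a → umbral 1ℚ k a ≡ Σ< (suc k) (λ j → ℕ→ℚ (k C j) * a j)
  umbral-1 zero    a = sym (trans (+-identityˡ (1ℚ * a 0)) (*-identityˡ (a 0)))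
  umbral-1 (suc k) a = begin
    1ℚ * umbral 1ℚ k a + umbral 1ℚ k (a ∘ suc)
      -- The vanishing term `top` is appended so that, once `f 0` is split off, both sums have the
      -- same length and Pascal's rule applies termwise.
      ≡⟨ cong₂ _+_ (trans (*-identityˡ (umbral 1ℚ k a)) (trans (umbral-1 k a) (sym (trans (cong (_+_ (Σ< (suc k) f)) top) (+-identityʳ (Σ< (suc k) f))))))
                   (umbral-1 k (a ∘ suc)) ⟩
    Σ< (suc (suc k)) f + Σ< (suc k) g
      ≡⟨ cong (_+ Σ< (suc k) g) (Σ<-suc (suc k) f) ⟩
    (f 0 + Σ< (suc k) (f ∘ suc)) + Σ< (suc k) g
      ≡⟨ solve 3 (λ x y z → (x :+ y) :+ z := x :+ (z :+ y)) refl (f 0) (Σ< (suc k) (f ∘ suc)) (Σ< (suc k) g) ⟩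
    f 0 + (Σ< (suc k) g + Σ< (suc k) (f ∘ suc))
      ≡⟨ cong (_+_ (f 0)) (sym (Σ<-+ (suc k) g (f ∘ suc))) ⟩
    f 0 + Σ< (suc k) (g ⊕ f ∘ suc)
      ≡⟨ cong (_+_ (f 0)) (Σ<-cong (suc k) pascal) ⟩
    h 0 + Σ< (suc k) (h ∘ suc)
      ≡⟨ sym (Σ<-suc (suc k) h) ⟩
    Σ< (suc (suc k)) h ∎
    where
    f g h : ℕ → ℚ
    f j = ℕ→ℚ (k C j) * a j
    g j = ℕ→ℚ (k C j) * a (suc j)
    h j = ℕ→ℚ (suc k C j) * a j
    top : f (suc k) ≡ 0ℚ
    top = trans (cong (λ n → ℕ→ℚ n * a (suc k)) (k>n⇒nCk≡0 (ℕ.n<1+n k))) (*-zeroˡ (a (suc k)))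
    pascal : g ⊕ f ∘ suc ≗ h ∘ suc
    pascal j = trans (sym (*-distribʳ-+ (a (suc j)) (ℕ→ℚ (k C j)) (ℕ→ℚ (k C suc j))))
      (cong (_* a (suc j)) (trans (sym (ℕ→ℚ-+ (k C j) (k C suc j))) (cong ℕ→ℚ (nCk+nC[k+1]≡[n+1]C[k+1] k j))))

  dot-snoc : ∀ w k xs y → dot w k (xs ++ y ∷ []) ≡ dot w k xs + w (k ℕ.+ length xs) * y
  dot-snoc w k []       y = trans (+-comm (w k * y) 0ℚ) (cong (λ n → 0ℚ + w n * y) (sym (ℕ.+-identityʳ k)))
  dot-snoc w k (x ∷ xs) y = trans (cong (_+_ (w k * x)) (dot-snoc w (suc k) xs y))
    (trans (sym (+-assoc (w k * x) (dot w (suc k) xs) (w (suc k ℕ.+ length xs) * y)))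
      (cong (λ n → (w k * x + dot w (suc k) xs) + w n * y) (sym (ℕ.+-suc k (length xs)))))

  length-bernList : ∀ m → length (bernList m) ≡ m
  length-bernList zero    = refl
  length-bernList (suc m) = trans (length-++ (bernList m)) (trans (ℕ.+-comm (length (bernList m)) 1) (cong suc (length-bernList m)))

  dot-bernList : ∀ w m → dot w 0 (bernList m) ≡ Σ< m (λ j → w j * B j)
  dot-bernList w zero    = refl
  dot-bernList w (suc m) = trans (dot-snoc w 0 (bernList m) (B m))
    (cong₂ (λ s n → s + w n * B m) (dot-bernList w m) (length-bernList m))

  -- For k = m + 2 the definition of B_{m+1} says that the term C(m + 2, m + 1) B_{m+1} = (m + 2)
  -- B_{m+1} cancels all terms before it, so only B_{m+2} is left.
  B-recurrence : ∀ k → umbral 1ℚ k B ≡ B k + monomial 1ℚ 1 k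
  B-recurrence zero          = sym (+-identityʳ (B 0))
  B-recurrence (suc zero)    = refl
  B-recurrence (suc (suc m)) = begin
    umbral 1ℚ (suc (suc m)) B
      ≡⟨ umbral-1 (suc (suc m)) B ⟩
    (Σ< (suc m) f + f (suc m)) + f (suc (suc m))
      ≡⟨ cong₂ (λ u v → (s + u) + v) penultimate last ⟩
    (s + - s) + B (suc (suc m))
      ≡⟨ solve 2 (λ s b → (s :+ (:- s)) :+ b := b :+ con 0ℚ) refl s (B (suc (suc m))) ⟩
    B (suc (suc m)) + 0ℚ ∎
    where
    f : ℕ → ℚ
    f j = ℕ→ℚ (suc (suc m) C j) * B j
    s q M : ℚ
    s = Σ< (suc m) f
    q = + 1 / suc (suc m)
    M = ℕ→ℚ (suc (suc m))
    last : f (suc (suc m)) ≡ B (suc (suc m))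
    last = trans (cong (λ n → ℕ→ℚ n * B (suc (suc m))) (nCn≡1 (suc (suc m)))) (*-identityˡ (B (suc (suc m))))
    [m+2]C[m+1] : suc (suc m) C suc m ≡ suc (suc m)
    [m+2]C[m+1] = trans (nCk≡nC[n∸k] (ℕ.n≤1+n (suc m)))
      (trans (cong (suc (suc m) C_) (ℕ.m+n∸n≡m 1 m)) (nC1≡n (suc (suc m))))
    penultimate : f (suc m) ≡ - s
    penultimate = begin
      ℕ→ℚ (suc (suc m) C suc m) * B (suc m)
        ≡⟨ cong₂ (λ n x → ℕ→ℚ n * x) [m+2]C[m+1] (trans (nextB-dot m (bernList (suc m)))
             (cong (λ t → - (q * t)) (trans (dot-bernList (bernoulliWeight m) (suc m))
               (Σ<-cong (suc m) λ j → cong (_* B j) (bernoulliWeight-def m j))))) ⟩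
      M * - (q * s)
        ≡⟨ solve 3 (λ M q s → M :* (:- (q :* s)) := :- ((q :* M) :* s)) refl M q s ⟩
      - ((q * M) * s)
        ≡⟨ cong (λ t → - (t * s)) (1/n*n≡1 (suc m)) ⟩
      - (1ℚ * s)
        ≡⟨ cong -_ (*-identityˡ s) ⟩
      - s ∎

  -- p-adic integrality

  x*↧x≡↥x : ∀ x → x * ℕ→ℚ (↧ₙ x) ≡ ↥ x / 1
  x*↧x≡↥x x@(mkℚ n d-1 _) = toℚᵘ-injective (ℚᵘ.≃-trans (toℚᵘ-homo-* x (ℕ→ℚ (suc d-1)))
    (ℚᵘ.≃-trans (ℚᵘ.*-congˡ {toℚᵘ x} (toℚᵘ-/1 (+ suc d-1)))
    (ℚᵘ.≃-trans (ℚᵘ.*≡* (ℤ.*-assoc n (+ suc d-1) (+ 1))) (ℚᵘ.≃-sym (toℚᵘ-/1 n)))))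

  ^^-+ : ∀ x j k → x ^^ (j ℕ.+ k) ≡ x ^^ j * x ^^ k
  ^^-+ x zero    k = sym (*-identityˡ (x ^^ k))
  ^^-+ x (suc j) k = trans (cong (x *_) (^^-+ x j k)) (sym (*-assoc x (x ^^ j) (x ^^ k)))

  ℕ→ℚ-^ : ∀ m k → ℕ→ℚ (m ℕ.^ k) ≡ ℕ→ℚ m ^^ k
  ℕ→ℚ-^ m zero    = refl
  ℕ→ℚ-^ m (suc k) = trans (ℕ→ℚ-* m (m ℕ.^ k)) (cong (ℕ→ℚ m *_) (ℕ→ℚ-^ m k))

  module PAdic (p : ℕ) (p-prime : Prime p) where

    instance
      p-nonZero : ℕ.NonZero p
      p-nonZero = prime⇒nonZero p-prime

    P : ℚ
    P = ℕ→ℚ p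

    -- The localisation of ℤ at p. The witnessing fraction need not be in lowest terms, so sums and
    -- products require no reduction.
    record Integral (x : ℚ) : Set where
      constructor integral
      field
        {numerator}   : ℤ
        {denominator} : ℕ
        p∤denominator : p ∤ denominator
        equation      : x * ℕ→ℚ denominator ≡ numerator / 1

    ∤-* : ∀ {m n} → p ∤ m → p ∤ n → p ∤ m ℕ.* n
    ∤-* {m} {n} h h′ d = [ h , h′ ]′ (euclidsLemma m n p-prime d)

    <⇒∤ : ∀ n → suc n ℕ.< p → p ∤ suc n
    <⇒∤ n lt d = ℕ.<⇒≱ lt (∣⇒≤ d)

    /1-integral : ∀ n → Integral (n / 1)
    /1-integral n = integral {numerator = n} {1} (λ d → ℕ.<⇒≱ (ℕ.nonTrivial⇒n>1 p {{prime⇒nonTrivial p-prime}}) (∣⇒≤ d)) (*-identityʳ (n / 1))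

    ℕ-integral : ∀ n → Integral (ℕ→ℚ n)
    ℕ-integral n = /1-integral (+ n)

    1/n-integral : ∀ n → suc n ℕ.< p → Integral (+ 1 / suc n)
    1/n-integral n lt = integral {numerator = + 1} (<⇒∤ n lt) (1/n*n≡1 n)

    integral-+ : ∀ {x y} → Integral x → Integral y → Integral (x + y)
    integral-+ {x} {y} (integral {a} {m} h e) (integral {b} {n} h′ e′) = integral {numerator = a ℤ.* + n ℤ.+ b ℤ.* + m} (∤-* h h′) (begin
      (x + y) * ℕ→ℚ (m ℕ.* n)
        ≡⟨ cong ((x + y) *_) (ℕ→ℚ-* m n) ⟩
      (x + y) * (ℕ→ℚ m * ℕ→ℚ n)
        ≡⟨ solve 4 (λ x y m n → (x :+ y) :* (m :* n) := x :* m :* n :+ y :* n :* m) refl x y (ℕ→ℚ m) (ℕ→ℚ n) ⟩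
      x * ℕ→ℚ m * ℕ→ℚ n + y * ℕ→ℚ n * ℕ→ℚ m
        ≡⟨ cong₂ (λ u v → u * ℕ→ℚ n + v * ℕ→ℚ m) e e′ ⟩
      a / 1 * ℕ→ℚ n + b / 1 * ℕ→ℚ m
        ≡⟨ sym (trans (/1-homo-+ (a ℤ.* + n) (b ℤ.* + m)) (cong₂ _+_ (/1-homo-* a (+ n)) (/1-homo-* b (+ m)))) ⟩
      (a ℤ.* + n ℤ.+ b ℤ.* + m) / 1 ∎)

    integral-* : ∀ {x y} → Integral x → Integral y → Integral (x * y)
    integral-* {x} {y} (integral {a} {m} h e) (integral {b} {n} h′ e′) = integral {numerator = a ℤ.* b} (∤-* h h′) (begin
      (x * y) * ℕ→ℚ (m ℕ.* n)
        ≡⟨ cong ((x * y) *_) (ℕ→ℚ-* m n) ⟩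
      (x * y) * (ℕ→ℚ m * ℕ→ℚ n)
        ≡⟨ solve 4 (λ x y m n → (x :* y) :* (m :* n) := x :* m :* (y :* n)) refl x y (ℕ→ℚ m) (ℕ→ℚ n) ⟩
      (x * ℕ→ℚ m) * (y * ℕ→ℚ n)
        ≡⟨ cong₂ _*_ e e′ ⟩
      a / 1 * (b / 1)
        ≡⟨ sym (/1-homo-* a b) ⟩
      (a ℤ.* b) / 1 ∎)

    integral-^^ : ∀ {x} k → Integral x → Integral (x ^^ k)
    integral-^^ zero    h = /1-integral (+ 1)
    integral-^^ (suc k) h = integral-* h (integral-^^ k h)

    -- x ∈ p^k ℤ_(p)
    record Pow (k : ℕ) (x : ℚ) : Set where
      constructor pow
      field
        {quotient}        : ℚ
        quotient-integral : Integral quotient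
        factorisation     : x ≡ P ^^ k * quotient

    pow-0ℚ : ∀ {k} → Pow k 0ℚ
    pow-0ℚ {k} = pow (/1-integral (+ 0)) (sym (*-zeroʳ (P ^^ k)))

    pow-+ : ∀ {k x y} → Pow k x → Pow k y → Pow k (x + y)
    pow-+ {k} (pow {u} h e) (pow {v} h′ e′) = pow (integral-+ h h′) (trans (cong₂ _+_ e e′) (sym (*-distribˡ-+ (P ^^ k) u v)))

    pow-* : ∀ {j k x y} → Pow j x → Pow k y → Pow (j ℕ.+ k) (x * y)
    pow-* {j} {k} (pow {u} h e) (pow {v} h′ e′) = pow (integral-* h h′) (trans (cong₂ _*_ e e′)
      (trans (solve 4 (λ a b c d → a :* b :* (c :* d) := (a :* c) :* (b :* d)) refl (P ^^ j) u (P ^^ k) v)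
        (cong (_* (u * v)) (sym (^^-+ P j k)))))

    integral⇒pow : ∀ {x} → Integral x → Pow 0 x
    integral⇒pow {x} h = pow h (sym (*-identityˡ x))

    pow-scale : ∀ {k c x} → Integral c → Pow k x → Pow k (c * x)
    pow-scale h h′ = pow-* (integral⇒pow h) h′

    pow-neg : ∀ {k x} → Pow k x → Pow k (- x)
    pow-neg {k} {x} h = subst (Pow k) (solve 1 (λ x → con (- 1ℚ) :* x := :- x) refl x) (pow-scale (/1-integral ℤ.-1ℤ) h)

    pow-weaken : ∀ j {k x} → Pow (k ℕ.+ j) x → Pow k x
    pow-weaken j {k} {x} (pow {u} h e) = pow (integral-* (integral-^^ j (ℕ-integral p)) h)
      (trans e (trans (cong (_* u) (^^-+ P k j)) (*-assoc (P ^^ k) (P ^^ j) u)))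

    pow⇒integral : ∀ {k x} → Pow k x → Integral x
    pow⇒integral {k} (pow h e) = subst Integral (sym e) (integral-* (integral-^^ k (ℕ-integral p)) h)

    P^-pow : ∀ k → Pow k (P ^^ k)
    P^-pow k = pow (/1-integral (+ 1)) (sym (*-identityʳ (P ^^ k)))

    pow-cancel : ∀ {k x} n → suc n ℕ.< p → Pow k (ℕ→ℚ (suc n) * x) → Pow k x
    pow-cancel {k} {x} n lt h = subst (Pow k)
      (trans (sym (*-assoc (+ 1 / suc n) (ℕ→ℚ (suc n)) x)) (trans (cong (_* x) (1/n*n≡1 n)) (*-identityˡ x)))
      (pow-scale (1/n-integral n lt) h)

    integral-cancel : ∀ {x} n → suc n ℕ.< p → Integral (ℕ→ℚ (suc n) * x) → Integral x
    integral-cancel n lt h = pow⇒integral (pow-cancel n lt (integral⇒pow h))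

    ^∣*⇒^∣ : ∀ k {m n} → p ∤ n → p ℕ.^ k ∣ m ℕ.* n → p ℕ.^ k ∣ m
    ^∣*⇒^∣ zero    {m} h d = divides m (sym (ℕ.*-identityʳ m))
    ^∣*⇒^∣ (suc k) {m} {n} h d with euclidsLemma m n p-prime (∣-trans (m∣m*n (p ℕ.^ k)) d)
    ... | inj₂ p∣n = contradiction p∣n h
    ... | inj₁ (divides m′ refl) with ^∣*⇒^∣ k {m′} h (*-cancelˡ-∣ p (subst (p ℕ.* p ℕ.^ k ∣_)
            (trans (cong (ℕ._* n) (ℕ.*-comm m′ p)) (ℕ.*-assoc p m′ n)) d))
    ...   | divides q refl = divides q (trans (ℕ.*-assoc q (p ℕ.^ k) p) (cong (q ℕ.*_) (ℕ.*-comm (p ℕ.^ k) p)))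

    -- Passes from an arbitrary fraction to lowest terms n / d through n b = p^k a d with p not
    -- dividing b. Euclid's lemma moves p^k into n; and d, being coprime to n, divides b, so p
    -- cannot divide d.
    pow⇒InPowZp : ∀ {k x} → Pow k x → InPowZp p k x
    pow⇒InPowZp {k} {x@(mkℚ n d-1 c)} (pow {y} (integral {a} {b} p∤b e) e′) =
      ^∣*⇒^∣ k p∤b (divides (∣ a ∣ ℕ.* d) (trans main (trans (ℕ.*-assoc (p ℕ.^ k) ∣ a ∣ d) (ℕ.*-comm (p ℕ.^ k) (∣ a ∣ ℕ.* d))))) ,
      λ p∣d → p∤b (∣-trans p∣d (coprime-divisor (Coprime-sym (recompute-coprime c)) (divides (p ℕ.^ k ℕ.* ∣ a ∣) main)))
      where
      d : ℕ
      d = suc d-1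
      overℤ : n ℤ.* + b ≡ + (p ℕ.^ k) ℤ.* a ℤ.* + d
      overℤ = /1-injective (begin
        (n ℤ.* + b) / 1               ≡⟨ /1-homo-* n (+ b) ⟩
        n / 1 * ℕ→ℚ b                 ≡⟨ cong (_* ℕ→ℚ b) (sym (x*↧x≡↥x x)) ⟩
        x * ℕ→ℚ d * ℕ→ℚ b             ≡⟨ cong (λ z → z * ℕ→ℚ d * ℕ→ℚ b) e′ ⟩
        P ^^ k * y * ℕ→ℚ d * ℕ→ℚ b    ≡⟨ solve 4 (λ q y d b → q :* y :* d :* b := q :* (y :* b) :* d) refl (P ^^ k) y (ℕ→ℚ d) (ℕ→ℚ b) ⟩
        P ^^ k * (y * ℕ→ℚ b) * ℕ→ℚ d  ≡⟨ cong₂ (λ q z → q * z * ℕ→ℚ d) (sym (ℕ→ℚ-^ p k)) e ⟩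
        ℕ→ℚ (p ℕ.^ k) * (a / 1) * ℕ→ℚ d ≡⟨ cong (_* ℕ→ℚ d) (sym (/1-homo-* (+ (p ℕ.^ k)) a)) ⟩
        (+ (p ℕ.^ k) ℤ.* a) / 1 * ℕ→ℚ d ≡⟨ sym (/1-homo-* (+ (p ℕ.^ k) ℤ.* a) (+ d)) ⟩
        (+ (p ℕ.^ k) ℤ.* a ℤ.* + d) / 1 ∎)
      main : ∣ n ∣ ℕ.* b ≡ p ℕ.^ k ℕ.* ∣ a ∣ ℕ.* d
      main = begin
        ∣ n ∣ ℕ.* b                         ≡⟨ sym (ℤ.abs-* n (+ b)) ⟩
        ∣ n ℤ.* + b ∣                       ≡⟨ cong ∣_∣ overℤ ⟩
        ∣ + (p ℕ.^ k) ℤ.* a ℤ.* + d ∣       ≡⟨ ℤ.abs-* (+ (p ℕ.^ k) ℤ.* a) (+ d) ⟩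
        ∣ + (p ℕ.^ k) ℤ.* a ∣ ℕ.* d         ≡⟨ cong (ℕ._* d) (ℤ.abs-* (+ (p ℕ.^ k)) a) ⟩
        p ℕ.^ k ℕ.* ∣ a ∣ ℕ.* d             ∎

  -- Even series and the truncated exponential

  ½ ⅙ : ℚ
  ½ = + 1 / 2
  ⅙ = + 1 / 6

  -- The default 0 at index 0 gives every series divided by its index the constant term 0, as
  -- `Small` demands.
  recip : ℕ → ℚ
  recip zero    = 0ℚ
  recip (suc n) = + 1 / suc n

  -- One induction for parity, divisibility by powers of p, and vanishing of coefficients of
  -- products.
  ⊛-closed : ∀ (Q : ℚ → Set) → (∀ {x y} → Q x → Q y → Q (x + y)) →
    ∀ f g n → (∀ i j → i ℕ.+ j ≡ n → Q (f i * g j)) → Q ((f ⊛ g) n)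
  ⊛-closed Q Q+ f g zero    h = h 0 0 refl
  ⊛-closed Q Q+ f g (suc n) h = Q+ (h 0 (suc n) refl) (⊛-closed Q Q+ (f ∘ suc) g n λ i j e → h (suc i) j (cong suc e))

  -- This is f(-X) = f(X). In this form evenness passes through products termwise, since (-1)^(i+j)
  -- factors; `even-at-odd` recovers the vanishing.
  Even : Series → Set
  Even f = ∀ n → neg1^ n * f n ≡ f n

  even-⊛ : ∀ {f g} → Even f → Even g → Even (f ⊛ g)
  even-⊛ {f} {g} ef eg n = ⊛-closed (λ x → neg1^ n * x ≡ x)
    (λ {x} {y} e e′ → trans (*-distribˡ-+ (neg1^ n) x y) (cong₂ _+_ e e′)) f g n
    λ i j e → trans (cong (λ m → neg1^ m * (f i * g j)) (sym e))
      (trans (cong (_* (f i * g j)) (^^-+ (- 1ℚ) i j))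
      (trans (solve 4 (λ s t x y → (s :* t) :* (x :* y) := (s :* x) :* (t :* y)) refl (neg1^ i) (neg1^ j) (f i) (g j))
        (cong₂ _*_ (ef i) (eg j))))

  even-at-odd : ∀ {f} → Even f → ∀ n → neg1^ n ≡ - 1ℚ → f n ≡ 0ℚ
  even-at-odd {f} ef n odd = begin
    f n                       ≡⟨ solve 1 (λ x → x := con ½ :* (x :+ x)) refl (f n) ⟩
    ½ * (f n + f n)           ≡⟨ cong (λ x → ½ * (f n + x)) (trans (sym (ef n)) (cong (_* f n) odd)) ⟩
    ½ * (f n + - 1ℚ * f n)    ≡⟨ solve 1 (λ x → con ½ :* (x :+ con (- 1ℚ) :* x) := con 0ℚ) refl (f n) ⟩
    0ℚ ∎

  neg1^-pred : ∀ n → neg1^ (suc n) ≡ 1ℚ → neg1^ n ≡ - 1ℚ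
  neg1^-pred n e = trans (solve 1 (λ s → s := :- (con (- 1ℚ) :* s)) refl (neg1^ n)) (cong -_ e)

  powerSums-0 : ∀ xs → powerSums xs 0 ≡ 0ℚ
  powerSums-0 []       = refl
  powerSums-0 (x ∷ xs) = trans (+-identityˡ (powerSums xs 0)) (powerSums-0 xs)

  module TruncatedExponential (G S : Series) (S≗θG : S ≗ θ G) where

    U W H : Series
    U = G ⊛ G
    W = U ⊛ G
    H = monomial 1ℚ 0 ⊕ (- 1ℚ) ⋆ G ⊕ ½ ⋆ U ⊕ (- ⅙) ⋆ W

    private
      θU : θ U ≗ S ⊛ G ⊕ S ⊛ G
      θU n = trans (θ-⊛ G G n) (cong₂ _+_ (⊛-congʳ G (sym ∘ S≗θG) n)
        (trans (⊛-comm G (θ G) n) (⊛-congʳ G (sym ∘ S≗θG) n)))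

      θW : θ W ≗ S ⊛ U ⊕ S ⊛ U ⊕ S ⊛ U
      θW n = trans (θ-⊛ U G n) (trans (cong₂ _+_ (⊛-congʳ G θU n) (⊛-congˡ U (sym ∘ S≗θG) n)) (rearrange S G n))
        where
        rearrange : ∀ S G → (S ⊛ G ⊕ S ⊛ G) ⊛ G ⊕ (G ⊛ G) ⊛ S ≗ S ⊛ (G ⊛ G) ⊕ S ⊛ (G ⊛ G) ⊕ S ⊛ (G ⊛ G)
        rearrange = SeriesSolver.solve 2 (λ S G → (S ⊗ G ⊞ S ⊗ G) ⊗ G ⊞ (G ⊗ G) ⊗ S ⊜ S ⊗ (G ⊗ G) ⊞ S ⊗ (G ⊗ G) ⊞ S ⊗ (G ⊗ G)) λ _ → refl
          where open SeriesSolver renaming (_:+_ to _⊞_; _:*_ to _⊗_; _:=_ to _⊜_)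

      S⊛H : ∀ n → (S ⊛ H) n ≡ S n + - 1ℚ * (S ⊛ G) n + ½ * (S ⊛ U) n + (- ⅙) * (S ⊛ W) n
      S⊛H n = trans (⊛-distribˡ S (monomial 1ℚ 0 ⊕ (- 1ℚ) ⋆ G ⊕ ½ ⋆ U) ((- ⅙) ⋆ W) n)
        (cong₂ _+_ (trans (⊛-distribˡ S (monomial 1ℚ 0 ⊕ (- 1ℚ) ⋆ G) (½ ⋆ U) n)
          (cong₂ _+_ (trans (⊛-distribˡ S (monomial 1ℚ 0) ((- 1ℚ) ⋆ G) n)
            (cong₂ _+_ (trans (⊛-comm S (monomial 1ℚ 0) n) (trans (monomial0-⊛ 1ℚ S n) (*-identityˡ (S n))))
              (⊛-⋆ (- 1ℚ) S G n))) (⊛-⋆ ½ S U n))) (⊛-⋆ (- ⅙) S W n))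

      θ-one : ∀ n → ℕ→ℚ n * monomial 1ℚ 0 n ≡ 0ℚ
      θ-one zero    = refl
      θ-one (suc n) = *-zeroʳ (ℕ→ℚ (suc n))

    -- The full series exp(-G) would satisfy θH = -S H. For the truncation, `θ` of each term cancels
    -- against S times the preceding term, and only S times the last term is left over.
    θH : ∀ n → θ H n ≡ - (S ⊛ H) n - ⅙ * (S ⊛ W) n
    θH n = begin
      ℕ→ℚ n * (monomial 1ℚ 0 n + - 1ℚ * G n + ½ * U n + (- ⅙) * W n)
        ≡⟨ solve 5 (λ m o g u w → m :* (o :+ con (- 1ℚ) :* g :+ con ½ :* u :+ con (- ⅙) :* w)
             := m :* o :+ con (- 1ℚ) :* (m :* g) :+ con ½ :* (m :* u) :+ con (- ⅙) :* (m :* w)) refl (ℕ→ℚ n) (monomial 1ℚ 0 n) (G n) (U n) (W n) ⟩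
      ℕ→ℚ n * monomial 1ℚ 0 n + - 1ℚ * θ G n + ½ * θ U n + (- ⅙) * θ W n
        ≡⟨ cong₂ _+_ (cong₂ _+_ (cong₂ (λ o g → o + - 1ℚ * g) (θ-one n) (sym (S≗θG n))) (cong (½ *_) (θU n))) (cong (- ⅙ *_) (θW n)) ⟩
      0ℚ + - 1ℚ * S n + ½ * ((S ⊛ G) n + (S ⊛ G) n) + (- ⅙) * ((S ⊛ U) n + (S ⊛ U) n + (S ⊛ U) n)
        ≡⟨ solve 4 (λ s g u w → con 0ℚ :+ con (- 1ℚ) :* s :+ con ½ :* (g :+ g) :+ con (- ⅙) :* (u :+ u :+ u)
             := (:- (s :+ con (- 1ℚ) :* g :+ con ½ :* u :+ con (- ⅙) :* w)) :- con ⅙ :* w) refl (S n) ((S ⊛ G) n) ((S ⊛ U) n) ((S ⊛ W) n) ⟩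
      - (S n + - 1ℚ * (S ⊛ G) n + ½ * (S ⊛ U) n + (- ⅙) * (S ⊛ W) n) - ⅙ * (S ⊛ W) n
        ≡⟨ cong (λ x → - x - ⅙ * (S ⊛ W) n) (sym (S⊛H n)) ⟩
      - (S ⊛ H) n - ⅙ * (S ⊛ W) n ∎

  module SmallSeries (p : ℕ) (p-prime : Prime p) (m : ℕ) where
    open PAdic p p-prime

    record Small (a : ℕ) (f : Series) : Set where
      constructor small
      field
        at-0  : f 0 ≡ 0ℚ
        bound : ∀ j → j ℕ.≤ m → Pow a (f j)

    -- Holds one index beyond the range of the hypotheses: both constant terms vanish, so the
    -- coefficient at m + 1 only uses indices from 1 to m. With m = 2n - 1 this reaches 2n without
    -- any bound on the factors there.
    ⊛-bound : ∀ {a b f g} → Small a f → Small b g → ∀ n → n ℕ.≤ suc m → Pow (a ℕ.+ b) ((f ⊛ g) n)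
    ⊛-bound {a} {b} {f} {g} (small f0 fb) (small g0 gb) n le = ⊛-closed (Pow (a ℕ.+ b)) pow-+ f g n term
      where
      term : ∀ i j → i ℕ.+ j ≡ n → Pow (a ℕ.+ b) (f i * g j)
      term zero    j       e = subst (Pow (a ℕ.+ b)) (sym (trans (cong (_* g j) f0) (*-zeroˡ (g j)))) pow-0ℚ
      term (suc i) zero    e = subst (Pow (a ℕ.+ b)) (sym (trans (cong (f (suc i) *_) g0) (*-zeroʳ (f (suc i))))) pow-0ℚ
      term (suc i) (suc j) e = pow-* (fb (suc i) (ℕ.≤-trans (ℕ.m≤m+n (suc i) j) (ℕ.≤-trans (ℕ.≤-reflexive (sym (ℕ.+-suc i j))) i+1+j≤m)))
                                     (gb (suc j) (ℕ.≤-trans (ℕ.m≤n+m (suc j) i) i+1+j≤m))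
        where
        i+1+j≤m : i ℕ.+ suc j ℕ.≤ m
        i+1+j≤m = ℕ.s≤s⁻¹ (subst (ℕ._≤ suc m) (sym e) le)

    small-⊛ : ∀ {a b f g} → Small a f → Small b g → Small (a ℕ.+ b) (f ⊛ g)
    small-⊛ {g = g} sf sg = small (trans (cong (_* g 0) (Small.at-0 sf)) (*-zeroˡ (g 0)))
      λ j le → ⊛-bound sf sg j (ℕ.m≤n⇒m≤1+n le)

    small-⊕ : ∀ {a f g} → Small a f → Small a g → Small a (f ⊕ g)
    small-⊕ (small f0 fb) (small g0 gb) = small (cong₂ _+_ f0 g0) λ j le → pow-+ (fb j le) (gb j le)

    small-weaken : ∀ b {a f} → Small (a ℕ.+ b) f → Small a f
    small-weaken b (small f0 fb) = small f0 λ j le → pow-weaken b (fb j le)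

    small-⋆ : ∀ a {f} → Small 0 f → Small a ((P ^^ a) ⋆ f)
    small-⋆ a {f} (small f0 fb) = small (trans (cong (P ^^ a *_) f0) (*-zeroʳ (P ^^ a)))
      λ j le → subst (λ c → Pow c (P ^^ a * f j)) (ℕ.+-identityʳ a) (pow-* (P^-pow a) (fb j le))

  -- The congruence for power series coefficients

  -- Here p is `suc N` and 2n is `6 ℕ.+ k₀`, so that 2n - 1 and 2n - 2 are `5 ℕ.+ k₀` and `4 ℕ.+ k₀`
  -- by computation. The Bernoulli numbers enter only through their recurrence, so the list-based
  -- definition of `B` never unfolds.
  module Core (N : ℕ) (p-prime : Prime (suc N)) (k₀ : ℕ) (6+k₀≤N : 6 ℕ.+ k₀ ℕ.≤ N) (even : neg1^ (6 ℕ.+ k₀) ≡ 1ℚ)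
    (bern : ℕ → ℚ) (recurrence : ∀ k → umbral 1ℚ k bern ≡ bern k + monomial 1ℚ 1 k) where

    open PAdic (suc N) p-prime
    -- Sizes are recorded up to 2n - 1 only: at 2n = p - 1 they fail for `x` and `G`.
    open SmallSeries (suc N) p-prime (5 ℕ.+ k₀)
    open Bernoulli bern recurrence

    -- The easy part of von Staudt-Clausen: the recurrence at j + 1 expresses (j + 1) B_j by an
    -- integer and an integral combination of earlier B_i, and j + 1 is a unit at p.
    bern-integral : ∀ j → suc j ℕ.< suc N → Integral (bern j)
    bern-integral = <-rec _ step
      where
      step : ∀ j → (∀ {i} → i ℕ.< j → suc i ℕ.< suc N → Integral (bern i)) → suc j ℕ.< suc N → Integral (bern j)
      step j ih lt = integral-cancel j lt (subst Integral (sym j+1*bern) (integral-+ (δ-integral j)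
          (integral-* (/1-integral ℤ.-1ℤ) (remainder-closed Integral 1ℚ (/1-integral (+ 0)) integral-+ (integral-* (/1-integral (+ 1)))
            2 (suc j) bern λ i le → ih (i<j i le) (ℕ.<-trans (s≤s (i<j i le)) lt)))))
        where
        i<j : ∀ i → i ℕ.+ 2 ℕ.≤ suc j → i ℕ.< j
        i<j i le = ℕ.s≤s⁻¹ (subst (ℕ._≤ suc j) (ℕ.+-comm i 2) le)
        δ-integral : ∀ j → Integral (monomial 1ℚ 0 j)
        δ-integral zero    = /1-integral (+ 1)
        δ-integral (suc j) = /1-integral (+ 0)
        R c : ℚ
        R = remainder 2 1ℚ (suc j) bern
        c = binom 1 j
        j+1*bern : ℕ→ℚ (suc j) * bern j ≡ monomial 1ℚ 0 j + - 1ℚ * R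
        j+1*bern = begin
          ℕ→ℚ (suc j) * bern j
            ≡⟨ cong (_* bern j) (trans (ℕ→ℚ-suc j) (sym (binom-1 j))) ⟩
          c * bern j
            ≡⟨ solve 4 (λ c b b′ R → c :* b := (((b′ :+ c :* (con (1ℚ ^^ 1) :* b)) :+ con (1ℚ ^^ 2) :* R) :- b′) :+ con (- 1ℚ) :* R) refl
                 c (bern j) (bern (suc j)) R ⟩
          (((bern (suc j) + c * (1ℚ ^^ 1 * bern j)) + 1ℚ ^^ 2 * R) - bern (suc j)) + - 1ℚ * R
            ≡⟨ cong (λ t → (t - bern (suc j)) + - 1ℚ * R) (sym (trans (umbral-taylor 2 1ℚ (suc j) bern)
                 (cong (_+ 1ℚ ^^ 2 * R) (trans (taylor-suc 1 1ℚ j bern) (cong (_+ c * (1ℚ ^^ 1 * bern j)) (taylor-1 1ℚ (suc j) bern)))))) ⟩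
          (umbral 1ℚ (suc j) bern - bern (suc j)) + - 1ℚ * R
            ≡⟨ cong (λ t → (t - bern (suc j)) + - 1ℚ * R) (recurrence (suc j)) ⟩
          ((bern (suc j) + monomial 1ℚ 0 j) - bern (suc j)) + - 1ℚ * R
            ≡⟨ solve 3 (λ b d r → ((b :+ d) :- b) :+ r := d :+ r) refl (bern (suc j)) (monomial 1ℚ 0 j) (- 1ℚ * R) ⟩
          monomial 1ℚ 0 j + - 1ℚ * R ∎

    -- The even part of the Bernoulli series

    E β : Series
    E = bern ⊕ monomial ½ 1
    β n = recip n * E n

    E-even : Even E
    E-even zero          = *-identityˡ (E 0)
    E-even (suc zero)    = trans (*-distribˡ-+ (neg1^ 1) (bern 1) ½) (trans (cong (_+ neg1^ 1 * ½) (reflection 1))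
      (+-assoc (bern 1) 1ℚ (- 1ℚ * 1ℚ * ½)))
    E-even (suc (suc n)) = trans (cong (neg1^ (2 ℕ.+ n) *_) (+-identityʳ (bern (2 ℕ.+ n)))) (reflection (2 ℕ.+ n))

    β-even : Even β
    β-even n = trans (solve 3 (λ s r e → s :* (r :* e) := r :* (s :* e)) refl (neg1^ n) (recip n) (E n)) (cong (recip n *_) (E-even n))

    bern-odd : ∀ n → neg1^ (2 ℕ.+ n) ≡ - 1ℚ → bern (2 ℕ.+ n) ≡ 0ℚ
    bern-odd n odd = trans (sym (+-identityʳ (bern (2 ℕ.+ n)))) (even-at-odd E-even (2 ℕ.+ n) odd)

    -- Faulhaber's formula modulo p⁴

    b c d : Series
    b n = recip n * bern n
    -- Written as a product so that `[b⊛c]` can move the factor X/2 to the front.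
    c = monomial ½ 1 ⊛ bern
    d zero          = 0ℚ
    d (suc zero)    = 0ℚ
    d (suc (suc i)) = ⅙ * (ℕ→ℚ (suc i) * bern i)

    S G x y z ε : Series
    S = powerSums (range1 N)
    G n = recip n * S n
    x = P ^^ 1 ⋆ b
    y = P ^^ 2 ⋆ c
    z = P ^^ 3 ⋆ d
    ε n = G n - (x n + y n + z n)

    S≗θG : S ≗ θ G
    S≗θG zero    = trans (powerSums-0 (range1 N)) (sym (*-zeroˡ (G 0)))
    S≗θG (suc n) = sym (trans (solve 3 (λ m q s → m :* (q :* s) := (q :* m) :* s) refl (ℕ→ℚ (suc n)) (+ 1 / suc n) (S (suc n)))
      (trans (cong (_* S (suc n)) (1/n*n≡1 n)) (*-identityˡ (S (suc n)))))

    open TruncatedExponential G S S≗θG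

    c-suc : ∀ n → c (suc n) ≡ ½ * bern n
    c-suc n = monomial1-⊛-suc ½ bern n

    remainder-integral : ∀ r j → (∀ i → i ℕ.+ r ℕ.≤ j → suc i ℕ.< suc N) → Integral (remainder r P j bern)
    remainder-integral r j h = remainder-closed Integral P (/1-integral (+ 0)) integral-+ (integral-* (ℕ-integral (suc N))) r j bern
      λ i le → bern-integral i (h i le)

    ε-0 : ε 0 ≡ 0ℚ
    ε-0 = solve 3 (λ P s b → con 0ℚ :* s :- (P :* con 1ℚ :* (con 0ℚ :* b) :+ P :* (P :* con 1ℚ) :* (con 0ℚ :* b) :+ P :* (P :* (P :* con 1ℚ)) :* con 0ℚ) := con 0ℚ)
      refl P (S 0) (bern 0)

    -- For S_1 and S_2 Faulhaber's polynomial has degree at most 3 in p, so nothing is cut off; the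
    -- general expansion below starts with S_3.
    ε-1 : ε 1 ≡ 0ℚ
    ε-1 = begin
      1ℚ * S 1 - (P ^^ 1 * (1ℚ * b1) + P ^^ 2 * c 1 + P ^^ 3 * 0ℚ)
        ≡⟨ cong (λ t → 1ℚ * S 1 - (P ^^ 1 * (1ℚ * b1) + P ^^ 2 * t + P ^^ 3 * 0ℚ)) (c-suc 0) ⟩
      1ℚ * S 1 - (P ^^ 1 * (1ℚ * b1) + P ^^ 2 * (½ * b0) + P ^^ 3 * 0ℚ)
        ≡⟨ solve 5 (λ P s b0 b1 b2 → con 1ℚ :* s :- (P :* con 1ℚ :* (con 1ℚ :* b1) :+ P :* (P :* con 1ℚ) :* (con ½ :* b0) :+ P :* (P :* (P :* con 1ℚ)) :* con 0ℚ)
             := con ½ :* ((b2 :+ con (ℕ→ℚ 2) :* s) :- (P :* (P :* b0 :+ b1) :+ (P :* b1 :+ b2)))) refl P (S 1) b0 b1 (bern 2) ⟩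
      ½ * ((bern 2 + ℕ→ℚ 2 * S 1) - umbral P 2 bern)
        ≡⟨ cong (λ t → ½ * (t - umbral P 2 bern)) (sym (faulhaber N 0)) ⟩
      ½ * (umbral P 2 bern - umbral P 2 bern)
        ≡⟨ cong (½ *_) (+-inverseʳ (umbral P 2 bern)) ⟩
      0ℚ ∎
      where
      b0 b1 : ℚ
      b0 = bern 0
      b1 = bern 1

    ε-2 : ε 2 ≡ 0ℚ
    ε-2 = begin
      ½ * S 2 - (P ^^ 1 * (½ * b2) + P ^^ 2 * c 2 + P ^^ 3 * (⅙ * (1ℚ * b0)))
        ≡⟨ cong (λ t → ½ * S 2 - (P ^^ 1 * (½ * b2) + P ^^ 2 * t + P ^^ 3 * (⅙ * (1ℚ * b0)))) (c-suc 1) ⟩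
      ½ * S 2 - (P ^^ 1 * (½ * b2) + P ^^ 2 * (½ * b1) + P ^^ 3 * (⅙ * (1ℚ * b0)))
        ≡⟨ solve 6 (λ P s b0 b1 b2 b3 → con ½ :* s :- (P :* con 1ℚ :* (con ½ :* b2) :+ P :* (P :* con 1ℚ) :* (con ½ :* b1) :+ P :* (P :* (P :* con 1ℚ)) :* (con ⅙ :* (con 1ℚ :* b0)))
             := con ⅙ :* ((b3 :+ con (ℕ→ℚ 3) :* s) :- (P :* (P :* (P :* b0 :+ b1) :+ (P :* b1 :+ b2)) :+ (P :* (P :* b1 :+ b2) :+ (P :* b2 :+ b3))))) refl P (S 2) b0 b1 b2 (bern 3) ⟩
      ⅙ * ((bern 3 + ℕ→ℚ 3 * S 2) - umbral P 3 bern)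
        ≡⟨ cong (λ t → ⅙ * (t - umbral P 3 bern)) (sym (faulhaber N 1)) ⟩
      ⅙ * (umbral P 3 bern - umbral P 3 bern)
        ≡⟨ cong (⅙ *_) (+-inverseʳ (umbral P 3 bern)) ⟩
      0ℚ ∎
      where
      b0 b1 b2 : ℚ
      b0 = bern 0
      b1 = bern 1
      b2 = bern 2

    umbral-expansion : ∀ j → umbral P (4 ℕ.+ j) bern ≡
      (((bern (4 ℕ.+ j) + binom 1 (3 ℕ.+ j) * (P ^^ 1 * bern (3 ℕ.+ j))) + binom 2 (2 ℕ.+ j) * (P ^^ 2 * bern (2 ℕ.+ j)))
        + binom 3 (1 ℕ.+ j) * (P ^^ 3 * bern (1 ℕ.+ j))) + P ^^ 4 * remainder 4 P (4 ℕ.+ j) bern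
    umbral-expansion j = trans (umbral-taylor 4 P (4 ℕ.+ j) bern) (cong (_+ P ^^ 4 * remainder 4 P (4 ℕ.+ j) bern)
      (trans (taylor-suc 3 P (1 ℕ.+ j) bern) (cong (_+ binom 3 (1 ℕ.+ j) * (P ^^ 3 * bern (1 ℕ.+ j)))
      (trans (taylor-suc 2 P (2 ℕ.+ j) bern) (cong (_+ binom 2 (2 ℕ.+ j) * (P ^^ 2 * bern (2 ℕ.+ j)))
      (trans (taylor-suc 1 P (3 ℕ.+ j) bern) (cong (_+ binom 1 (3 ℕ.+ j) * (P ^^ 1 * bern (3 ℕ.+ j))) (taylor-1 P (4 ℕ.+ j) bern))))))))

    -- For i = 3 + j, Faulhaber's formula gives (i + 1) S_i while G_i is S_i / i, so the factor i (i
    -- + 1) clears all denominators. It turns b_i, c_i and d_i into the terms with C(i + 1, 1), C(i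
    -- + 1, 2) and C(i + 1, 3), and the rest of the expansion is the error.
    ε-remainder : ∀ j → ℕ→ℚ (4 ℕ.+ j) * (ℕ→ℚ (3 ℕ.+ j) * ε (3 ℕ.+ j)) ≡ P ^^ 4 * remainder 4 P (4 ℕ.+ j) bern
    ε-remainder j = begin
      K * (L * (q * s - (P ^^ 1 * (q * b3) + P ^^ 2 * c (3 ℕ.+ j) + P ^^ 3 * (⅙ * (I * b1)))))
        ≡⟨ cong (λ t → K * (L * (q * s - (P ^^ 1 * (q * b3) + P ^^ 2 * t + P ^^ 3 * (⅙ * (I * b1)))))) (c-suc (2 ℕ.+ j)) ⟩
      K * (L * (q * s - (P ^^ 1 * (q * b3) + P ^^ 2 * (½ * b2) + P ^^ 3 * (⅙ * (I * b1)))))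
        ≡⟨ solve 11 (λ K L q s P1 b3 P2 b2 P3 I b1 →
             K :* (L :* (q :* s :- (P1 :* (q :* b3) :+ P2 :* (con ½ :* b2) :+ P3 :* (con ⅙ :* (I :* b1)))))
             := (q :* L) :* (K :* s) :- ((q :* L) :* (K :* (P1 :* b3)) :+ K :* L :* (con ½ :* (P2 :* b2)) :+ K :* L :* I :* (con ⅙ :* (P3 :* b1)))) refl
             K L q s (P ^^ 1) b3 (P ^^ 2) b2 (P ^^ 3) I b1 ⟩
      (q * L) * (K * s) - ((q * L) * (K * (P ^^ 1 * b3)) + K * L * (½ * (P ^^ 2 * b2)) + K * L * I * (⅙ * (P ^^ 3 * b1)))
        ≡⟨ cong (λ t → t * (K * s) - (t * (K * (P ^^ 1 * b3)) + K * L * (½ * (P ^^ 2 * b2)) + K * L * I * (⅙ * (P ^^ 3 * b1)))) (1/n*n≡1 (2 ℕ.+ j)) ⟩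
      1ℚ * (K * s) - (1ℚ * (K * (P ^^ 1 * b3)) + K * L * (½ * (P ^^ 2 * b2)) + K * L * I * (⅙ * (P ^^ 3 * b1)))
        ≡⟨ solve 8 (λ t b4 K L I u v w → con 1ℚ :* t :- (con 1ℚ :* (K :* u) :+ K :* L :* (con ½ :* v) :+ K :* L :* I :* (con ⅙ :* w))
             := (b4 :+ t) :- b4 :- (K :* u :+ K :* L :* (con ½ :* v) :+ K :* L :* I :* (con ⅙ :* w))) refl
             (K * s) b4 K L I (P ^^ 1 * b3) (P ^^ 2 * b2) (P ^^ 3 * b1) ⟩
      (b4 + K * s) - b4 - main K L I
        ≡⟨ cong₂ (λ t v → t - b4 - v) (trans (sym (faulhaber N (2 ℕ.+ j))) (umbral-expansion j)) (main≡) ⟩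
      ((((b4 + binom 1 (3 ℕ.+ j) * (P ^^ 1 * b3)) + binom 2 (2 ℕ.+ j) * (P ^^ 2 * b2))
        + binom 3 (1 ℕ.+ j) * (P ^^ 3 * b1)) + P ^^ 4 * R) - b4 - main K′ L′ I′
        ≡⟨ cong₂ (λ e f → ((((b4 + e * (P ^^ 1 * b3)) + f * (P ^^ 2 * b2)) + binom 3 (1 ℕ.+ j) * (P ^^ 3 * b1)) + P ^^ 4 * R) - b4 - main K′ L′ I′)
             (trans (binom-1 (3 ℕ.+ j)) (cong (_+_ 1ℚ) L≡))
             (trans (binom-2 (2 ℕ.+ j)) (cong (λ t → ½ * ((1ℚ + t) * (1ℚ + (1ℚ + t)))) I≡)) ⟩
      ((((b4 + K′ * (P ^^ 1 * b3)) + ½ * ((1ℚ + I′) * (1ℚ + (1ℚ + I′))) * (P ^^ 2 * b2))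
        + binom 3 (1 ℕ.+ j) * (P ^^ 3 * b1)) + P ^^ 4 * R) - b4 - main K′ L′ I′
        ≡⟨ cong (λ f → ((((b4 + K′ * (P ^^ 1 * b3)) + ½ * ((1ℚ + I′) * (1ℚ + (1ℚ + I′))) * (P ^^ 2 * b2)) + f * (P ^^ 3 * b1)) + P ^^ 4 * R) - b4 - main K′ L′ I′)
             (binom-3 (1 ℕ.+ j)) ⟩
      ((((b4 + K′ * (P ^^ 1 * b3)) + ½ * ((1ℚ + I′) * (1ℚ + (1ℚ + I′))) * (P ^^ 2 * b2))
        + ⅙ * ((1ℚ + T) * ((1ℚ + (1ℚ + T)) * (1ℚ + (1ℚ + (1ℚ + T))))) * (P ^^ 3 * b1)) + P ^^ 4 * R) - b4 - main K′ L′ I′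
        ≡⟨ solve 6 (λ b4 u v w R T → let I = con 1ℚ :+ T ; L = con 1ℚ :+ I ; K = con 1ℚ :+ L in
             ((((b4 :+ K :* u) :+ con ½ :* ((con 1ℚ :+ I) :* (con 1ℚ :+ (con 1ℚ :+ I))) :* v)
               :+ con ⅙ :* ((con 1ℚ :+ T) :* ((con 1ℚ :+ (con 1ℚ :+ T)) :* (con 1ℚ :+ (con 1ℚ :+ (con 1ℚ :+ T))))) :* w) :+ R) :- b4
               :- (K :* u :+ K :* L :* (con ½ :* v) :+ K :* L :* I :* (con ⅙ :* w)) := R) refl
             b4 (P ^^ 1 * b3) (P ^^ 2 * b2) (P ^^ 3 * b1) (P ^^ 4 * R) T ⟩
      P ^^ 4 * R ∎
      where
      K L I T q s b1 b2 b3 b4 R I′ L′ K′ : ℚ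
      K = ℕ→ℚ (4 ℕ.+ j)
      L = ℕ→ℚ (3 ℕ.+ j)
      I = ℕ→ℚ (2 ℕ.+ j)
      T = ℕ→ℚ (1 ℕ.+ j)
      q = + 1 / (3 ℕ.+ j)
      s = S (3 ℕ.+ j)
      b1 = bern (1 ℕ.+ j)
      b2 = bern (2 ℕ.+ j)
      b3 = bern (3 ℕ.+ j)
      b4 = bern (4 ℕ.+ j)
      R = remainder 4 P (4 ℕ.+ j) bern
      I′ = 1ℚ + T
      L′ = 1ℚ + I′
      K′ = 1ℚ + L′
      main : ℚ → ℚ → ℚ → ℚ
      main K L I = K * (P ^^ 1 * b3) + K * L * (½ * (P ^^ 2 * b2)) + K * L * I * (⅙ * (P ^^ 3 * b1))
      I≡ : I ≡ I′
      I≡ = ℕ→ℚ-suc (1 ℕ.+ j)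
      L≡ : L ≡ L′
      L≡ = trans (ℕ→ℚ-suc (2 ℕ.+ j)) (cong (_+_ 1ℚ) I≡)
      K≡ : K ≡ K′
      K≡ = trans (ℕ→ℚ-suc (3 ℕ.+ j)) (cong (_+_ 1ℚ) L≡)
      main≡ : main K L I ≡ main K′ L′ I′
      main≡ = trans (cong₂ (λ u v → main u v I) K≡ L≡) (cong (main K′ L′) I≡)

    -- Isolates the term with p⁴ B_j. At the boundary 4 + j = p it must be seen to vanish, because
    -- one factor p is about to be divided out.
    remainder-4-5 : ∀ j → P ^^ 4 * remainder 4 P (4 ℕ.+ j) bern ≡
      binom 4 j * (P ^^ 4 * bern j) + P ^^ 5 * remainder 5 P (4 ℕ.+ j) bern
    remainder-4-5 j = begin
      P ^^ 4 * R
        ≡⟨ solve 2 (λ t r → r := (t :+ r) :- t) refl t (P ^^ 4 * R) ⟩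
      (t + P ^^ 4 * R) - t
        ≡⟨ cong (_- t) (trans (sym (umbral-taylor 4 P (4 ℕ.+ j) bern)) (trans (umbral-taylor 5 P (4 ℕ.+ j) bern)
             (cong (_+ P ^^ 5 * R′) (taylor-suc 4 P j bern)))) ⟩
      ((t + u) + P ^^ 5 * R′) - t
        ≡⟨ solve 3 (λ t u r → ((t :+ u) :+ r) :- t := u :+ r) refl t u (P ^^ 5 * R′) ⟩
      u + P ^^ 5 * R′ ∎
      where
      R R′ t u : ℚ
      R = remainder 4 P (4 ℕ.+ j) bern
      R′ = remainder 5 P (4 ℕ.+ j) bern
      t = taylor 4 P (4 ℕ.+ j) bern
      u = binom 4 j * (P ^^ 4 * bern j)

    ε-bound : ∀ i → i ℕ.≤ 6 ℕ.+ k₀ → Pow 4 (ε i)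
    ε-bound zero                le = subst (Pow 4) (sym ε-0) pow-0ℚ
    ε-bound (suc zero)          le = subst (Pow 4) (sym ε-1) pow-0ℚ
    ε-bound (suc (suc zero))    le = subst (Pow 4) (sym ε-2) pow-0ℚ
    ε-bound (suc (suc (suc j))) le with ℕ.m≤n⇒m<n∨m≡n (ℕ.≤-trans le 6+k₀≤N)
    ... | inj₁ 3+j<N = pow-cancel (2 ℕ.+ j) (ℕ.m<n⇒m<1+n 3+j<N) (pow-cancel (3 ℕ.+ j) (s≤s 3+j<N)
      (pow (remainder-integral 4 (4 ℕ.+ j) λ i i+4≤ → s≤s (ℕ.≤-trans (s≤s (i≤j i i+4≤)) (ℕ.≤-trans (ℕ.m≤n+m (suc j) 2) (ℕ.<⇒≤ 3+j<N))))
        (ε-remainder j)))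
      where
      i≤j : ∀ i → i ℕ.+ 4 ℕ.≤ 4 ℕ.+ j → i ℕ.≤ j
      i≤j i h = ℕ.+-cancelˡ-≤ 4 i j (subst (ℕ._≤ 4 ℕ.+ j) (ℕ.+-comm i 4) h)
    -- Here 4 + j = p, so dividing by ℕ→ℚ (4 + j) costs a factor p; it is regained because bern (p - 4) vanishes.
    ... | inj₂ 3+j≡N = pow-cancel (2 ℕ.+ j) (ℕ.≤-reflexive (cong suc 3+j≡N))
      (pow (remainder-integral 5 (4 ℕ.+ j) λ i i+5≤ → s≤s (ℕ.≤-trans (1+i≤j i i+5≤) (ℕ.≤-trans (ℕ.m≤n+m j 3) (ℕ.≤-reflexive 3+j≡N))))
        (*-cancel-suc N (begin
          P * (ℕ→ℚ (3 ℕ.+ j) * ε (3 ℕ.+ j))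
            ≡⟨ cong (λ n → ℕ→ℚ (suc n) * (ℕ→ℚ (3 ℕ.+ j) * ε (3 ℕ.+ j))) (sym 3+j≡N) ⟩
          ℕ→ℚ (4 ℕ.+ j) * (ℕ→ℚ (3 ℕ.+ j) * ε (3 ℕ.+ j))
            ≡⟨ trans (ε-remainder j) (remainder-4-5 j) ⟩
          binom 4 j * (P ^^ 4 * bern j) + P ^^ 5 * R
            ≡⟨ cong (λ t → binom 4 j * (P ^^ 4 * t) + P ^^ 5 * R) bern-j ⟩
          binom 4 j * (P ^^ 4 * 0ℚ) + P ^^ 5 * R
            ≡⟨ solve 4 (λ c P Q R → c :* (Q :* con 0ℚ) :+ (P :* Q) :* R := P :* (Q :* R)) refl (binom 4 j) P (P ^^ 4) R ⟩
          P * (P ^^ 4 * R) ∎)))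
      where
      R : ℚ
      R = remainder 5 P (4 ℕ.+ j) bern
      1+i≤j : ∀ i → i ℕ.+ 5 ℕ.≤ 4 ℕ.+ j → suc i ℕ.≤ j
      1+i≤j i h = ℕ.+-cancelˡ-≤ 4 (suc i) j (subst (ℕ._≤ 4 ℕ.+ j) (trans (ℕ.+-suc i 4) (ℕ.+-comm (suc i) 4)) h)
      j≡3+k₀ : j ≡ 3 ℕ.+ k₀
      j≡3+k₀ = ℕ.≤-antisym (ℕ.+-cancelˡ-≤ 3 j (3 ℕ.+ k₀) le)
                           (ℕ.+-cancelˡ-≤ 3 (3 ℕ.+ k₀) j (ℕ.≤-trans 6+k₀≤N (ℕ.≤-reflexive (sym 3+j≡N))))
      bern-j : bern j ≡ 0ℚ
      bern-j = trans (cong bern j≡3+k₀) (bern-odd (1 ℕ.+ k₀)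
        (trans (solve 1 (λ s → s := con (- 1ℚ) :* (con (- 1ℚ) :* s)) refl (neg1^ (3 ℕ.+ k₀))) (neg1^-pred (5 ℕ.+ k₀) even)))

    -- p-adic size of the pieces of G below index 2n

    <p : ∀ {j} → j ℕ.≤ 5 ℕ.+ k₀ → suc j ℕ.< suc N
    <p le = s≤s (ℕ.≤-trans (s≤s le) 6+k₀≤N)

    recip-integral : ∀ j → j ℕ.≤ 5 ℕ.+ k₀ → Integral (recip j)
    recip-integral zero    le = /1-integral (+ 0)
    recip-integral (suc j) le = 1/n-integral j (ℕ.<-trans (ℕ.n<1+n (suc j)) (<p le))

    ⅙-integral : Integral ⅙
    ⅙-integral = 1/n-integral 5 (s≤s (ℕ.≤-trans (ℕ.m≤m+n 6 k₀) 6+k₀≤N))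

    ½-integral : Integral ½
    ½-integral = 1/n-integral 1 (s≤s (ℕ.≤-trans (s≤s (s≤s z≤n)) 6+k₀≤N))

    b-small : Small 0 b
    b-small = small (*-zeroˡ (bern 0)) λ j le → integral⇒pow (integral-* (recip-integral j le) (bern-integral j (<p le)))

    c-small : Small 0 c
    c-small = small (*-zeroˡ (bern 0)) bound
      where
      bound : ∀ j → j ℕ.≤ 5 ℕ.+ k₀ → Pow 0 (c j)
      bound zero    le = subst (Pow 0) (sym (*-zeroˡ (bern 0))) pow-0ℚ
      bound (suc j) le = integral⇒pow (subst Integral (sym (c-suc j)) (integral-* ½-integral (bern-integral j (<p (ℕ.<⇒≤ le)))))

    d-small : Small 0 d
    d-small = small refl bound
      where
      bound : ∀ j → j ℕ.≤ 5 ℕ.+ k₀ → Pow 0 (d j)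
      bound zero          le = pow-0ℚ
      bound (suc zero)    le = pow-0ℚ
      bound (suc (suc j)) le = integral⇒pow (integral-* ⅙-integral (integral-* (ℕ-integral (suc j)) (bern-integral j (<p (ℕ.≤-trans (ℕ.m≤n+m j 2) le)))))

    r s : Series
    r = z ⊕ ε
    s = y ⊕ r

    x-small : Small 1 x
    x-small = small-⋆ 1 b-small

    y-small : Small 2 y
    y-small = small-⋆ 2 c-small

    r-small : Small 3 r
    r-small = small-⊕ (small-⋆ 3 d-small) (small-weaken 1 (small ε-0 λ j le → ε-bound j (ℕ.m≤n⇒m≤1+n le)))

    s-small : Small 2 s
    s-small = small-⊕ y-small (small-weaken 1 r-small)

    G-split : G ≗ x ⊕ s
    G-split n = solve 4 (λ g x y z → g := x :+ (y :+ (z :+ (g :- (x :+ y :+ z))))) refl (G n) (x n) (y n) (z n)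

    G-small : Small 1 G
    G-small = small (*-zeroˡ (S 0)) λ j le → subst (Pow 1) (sym (G-split j)) (Small.bound (small-⊕ x-small (small-weaken 1 s-small)) j le)

    S-small : Small 1 S
    S-small = small (powerSums-0 (range1 N)) λ j le → subst (Pow 1) (sym (S≗θG j)) (pow-scale (ℕ-integral j) (Small.bound G-small j le))

    S-integral : ∀ xs j → Integral (powerSums xs j)
    S-integral []       j = /1-integral (+ 0)
    S-integral (x ∷ xs) j = integral-+ (powers j) (S-integral xs j)
      where
      powers : ∀ j → Integral (positivePowers x j)
      powers zero    = /1-integral (+ 0)
      powers (suc j) = integral-^^ (suc j) (ℕ-integral x)

    -- Comparison of the signed elementary symmetric functions with the truncated exponential

    σ D : Series
    σ = signedElemSym (range1 N)
    D = σ ⊕ (- 1ℚ) ⋆ H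

    D-0 : D 0 ≡ 0ℚ
    D-0 = solve 1 (λ s → let g = con 0ℚ :* s in
       con 1ℚ :+ con (- 1ℚ) :* (con 1ℚ :+ con (- 1ℚ) :* g :+ con ½ :* (g :* g) :+ con (- ⅙) :* (g :* g :* g)) := con 0ℚ) refl (S 0)

    θD : ∀ n → ℕ→ℚ n * D n ≡ - (S ⊛ D) n + ⅙ * (S ⊛ W) n
    θD n = begin
      ℕ→ℚ n * (σ n + - 1ℚ * H n)
        ≡⟨ solve 3 (λ m s h → m :* (s :+ con (- 1ℚ) :* h) := m :* s :+ con (- 1ℚ) :* (m :* h)) refl (ℕ→ℚ n) (σ n) (H n) ⟩
      θ σ n + - 1ℚ * θ H n
        ≡⟨ cong₂ (λ u v → u + - 1ℚ * v) (trans (newton (range1 N) n) (cong (- 1ℚ *_) (⊛-comm σ S n))) (θH n) ⟩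
      - 1ℚ * (S ⊛ σ) n + - 1ℚ * (- (S ⊛ H) n - ⅙ * (S ⊛ W) n)
        ≡⟨ solve 3 (λ u v w → con (- 1ℚ) :* u :+ con (- 1ℚ) :* ((:- v) :- con ⅙ :* w) := (:- (u :+ con (- 1ℚ) :* v)) :+ con ⅙ :* w) refl
             ((S ⊛ σ) n) ((S ⊛ H) n) ((S ⊛ W) n) ⟩
      - ((S ⊛ σ) n + - 1ℚ * (S ⊛ H) n) + ⅙ * (S ⊛ W) n
        ≡⟨ cong (λ t → - t + ⅙ * (S ⊛ W) n) (sym (trans (⊛-distribˡ S σ ((- 1ℚ) ⋆ H) n) (cong (_+_ ((S ⊛ σ) n)) (⊛-⋆ (- 1ℚ) S H n)))) ⟩
      - (S ⊛ D) n + ⅙ * (S ⊛ W) n ∎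

    -- By `θD`, n D_n is a combination of the D_j with j < n, since S_0 = 0, plus a coefficient of S
    -- G³ / 6. The latter lies in p⁴ as a product of four series divisible by p, and n is a unit at
    -- p.
    σ≡H : ∀ n → n ℕ.≤ 6 ℕ.+ k₀ → Pow 4 (D n)
    σ≡H = <-rec _ step
      where
      step : ∀ n → (∀ {j} → j ℕ.< n → j ℕ.≤ 6 ℕ.+ k₀ → Pow 4 (D j)) → n ℕ.≤ 6 ℕ.+ k₀ → Pow 4 (D n)
      step zero    ih le = subst (Pow 4) (sym D-0) pow-0ℚ
      step (suc n) ih le = pow-cancel n (s≤s (ℕ.≤-trans le 6+k₀≤N)) (subst (Pow 4) (sym (θD (suc n)))
          (pow-+ (pow-neg (⊛-closed (Pow 4) pow-+ S D (suc n) term))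
                 (pow-scale ⅙-integral (⊛-bound S-small (small-⊛ (small-⊛ G-small G-small) G-small) (suc n) le))))
        where
        term : ∀ i j → i ℕ.+ j ≡ suc n → Pow 4 (S i * D j)
        term zero    j e = subst (Pow 4) (sym (trans (cong (_* D j) (powerSums-0 (range1 N))) (*-zeroˡ (D j)))) pow-0ℚ
        -- Integrality of S_i is enough, as D_j already carries p⁴; at i = 2n = p - 1 no more would
        -- be true.
        term (suc i) j e = pow-scale (S-integral (range1 N) (suc i)) (ih j<1+n (ℕ.≤-trans (ℕ.<⇒≤ j<1+n) le))
          where
          j<1+n : j ℕ.< suc n
          j<1+n = subst (j ℕ.<_) e (s≤s (ℕ.m≤n+m j i))

    -- The terms of G² and G³ of order at least 4 in p. With `x`, `s`, `r` of orders 1, 2, 3, only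
    -- x², 2 x y and x³ have smaller order.
    U-error W-error : Series
    U-error = x ⊛ r ⊕ x ⊛ r ⊕ s ⊛ s
    W-error = (x ⊛ x) ⊛ s ⊕ (x ⊛ x) ⊛ s ⊕ (x ⊛ x) ⊛ s ⊕ (x ⊛ (s ⊛ s) ⊕ x ⊛ (s ⊛ s) ⊕ x ⊛ (s ⊛ s) ⊕ (s ⊛ s) ⊛ s)

    U-split : U ≗ x ⊛ x ⊕ x ⊛ y ⊕ x ⊛ y ⊕ U-error
    U-split n = trans (⊛-cong G-split G-split n) (expand x y r n)
      where
      expand : ∀ x y r → (x ⊕ (y ⊕ r)) ⊛ (x ⊕ (y ⊕ r)) ≗ x ⊛ x ⊕ x ⊛ y ⊕ x ⊛ y ⊕ (x ⊛ r ⊕ x ⊛ r ⊕ (y ⊕ r) ⊛ (y ⊕ r))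
      expand = SeriesSolver.solve 3 (λ x y r → (x ⊞ (y ⊞ r)) ⊗ (x ⊞ (y ⊞ r)) ⊜ x ⊗ x ⊞ x ⊗ y ⊞ x ⊗ y ⊞ (x ⊗ r ⊞ x ⊗ r ⊞ (y ⊞ r) ⊗ (y ⊞ r))) λ _ → refl
        where open SeriesSolver renaming (_:+_ to _⊞_; _:*_ to _⊗_; _:=_ to _⊜_)

    W-split : W ≗ (x ⊛ x) ⊛ x ⊕ W-error
    W-split n = trans (⊛-cong (⊛-cong G-split G-split) G-split n) (expand x s n)
      where
      expand : ∀ x s → ((x ⊕ s) ⊛ (x ⊕ s)) ⊛ (x ⊕ s) ≗ (x ⊛ x) ⊛ x ⊕
        ((x ⊛ x) ⊛ s ⊕ (x ⊛ x) ⊛ s ⊕ (x ⊛ x) ⊛ s ⊕ (x ⊛ (s ⊛ s) ⊕ x ⊛ (s ⊛ s) ⊕ x ⊛ (s ⊛ s) ⊕ (s ⊛ s) ⊛ s))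
      expand = SeriesSolver.solve 2 (λ x s → ((x ⊞ s) ⊗ (x ⊞ s)) ⊗ (x ⊞ s) ⊜ (x ⊗ x) ⊗ x ⊞
        ((x ⊗ x) ⊗ s ⊞ (x ⊗ x) ⊗ s ⊞ (x ⊗ x) ⊗ s ⊞ (x ⊗ (s ⊗ s) ⊞ x ⊗ (s ⊗ s) ⊞ x ⊗ (s ⊗ s) ⊞ (s ⊗ s) ⊗ s))) λ _ → refl
        where open SeriesSolver renaming (_:+_ to _⊞_; _:*_ to _⊗_; _:=_ to _⊜_)

    U-error-bound : Pow 4 (U-error (6 ℕ.+ k₀))
    U-error-bound = pow-+ (pow-+ xr xr) (⊛-bound s-small s-small (6 ℕ.+ k₀) ℕ.≤-refl)
      where
      xr : Pow 4 ((x ⊛ r) (6 ℕ.+ k₀))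
      xr = ⊛-bound x-small r-small (6 ℕ.+ k₀) ℕ.≤-refl

    W-error-bound : Pow 4 (W-error (6 ℕ.+ k₀))
    W-error-bound = pow-+ (pow-+ (pow-+ xxs xxs) xxs) (pow-+ (pow-+ (pow-+ xss xss) xss)
        (pow-weaken 2 (⊛-bound (small-⊛ s-small s-small) s-small (6 ℕ.+ k₀) ℕ.≤-refl)))
      where
      xxs : Pow 4 (((x ⊛ x) ⊛ s) (6 ℕ.+ k₀))
      xxs = ⊛-bound (small-⊛ x-small x-small) s-small (6 ℕ.+ k₀) ℕ.≤-refl
      xss : Pow 4 ((x ⊛ (s ⊛ s)) (6 ℕ.+ k₀))
      xss = pow-weaken 1 (⊛-bound x-small (small-⊛ s-small s-small) (6 ℕ.+ k₀) ℕ.≤-refl)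

    approximation : ℚ
    approximation = - (P ^^ 1 * b M + P ^^ 2 * c M + P ^^ 3 * d M)
        + ½ * (P ^^ 2 * (b ⊛ b) M + (P ^^ 3 * (b ⊛ c) M + P ^^ 3 * (b ⊛ c) M))
        - ⅙ * (P ^^ 3 * ((b ⊛ b) ⊛ b) M)
      where
      M : ℕ
      M = 6 ℕ.+ k₀

    σ-approximation : Pow 4 (σ (6 ℕ.+ k₀) - approximation)
    σ-approximation = subst (Pow 4) (sym difference)
      (pow-+ (σ≡H M ℕ.≤-refl) (pow-+ (pow-neg (ε-bound M ℕ.≤-refl))
        (pow-+ (pow-scale ½-integral U-error-bound) (pow-neg (pow-scale ⅙-integral W-error-bound)))))
      where
      M : ℕ
      M = 6 ℕ.+ k₀
      ⋆-⊛-⋆ : ∀ u v f g n → ((u ⋆ f) ⊛ (v ⋆ g)) n ≡ u * (v * (f ⊛ g) n)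
      ⋆-⊛-⋆ u v f g n = trans (⋆-⊛ u f (v ⋆ g) n) (cong (u *_) (⊛-⋆ v f g n))
      xx : (x ⊛ x) M ≡ P ^^ 2 * (b ⊛ b) M
      xx = trans (⋆-⊛-⋆ (P ^^ 1) (P ^^ 1) b b M)
        (solve 2 (λ P t → P :* con 1ℚ :* (P :* con 1ℚ :* t) := P :* (P :* con 1ℚ) :* t) refl P ((b ⊛ b) M))
      xy : (x ⊛ y) M ≡ P ^^ 3 * (b ⊛ c) M
      xy = trans (⋆-⊛-⋆ (P ^^ 1) (P ^^ 2) b c M)
        (solve 2 (λ P t → P :* con 1ℚ :* (P :* (P :* con 1ℚ) :* t) := P :* (P :* (P :* con 1ℚ)) :* t) refl P ((b ⊛ c) M))
      xxx : ((x ⊛ x) ⊛ x) M ≡ P ^^ 3 * ((b ⊛ b) ⊛ b) M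
      xxx = trans (⊛-congʳ x (⋆-⊛-⋆ (P ^^ 1) (P ^^ 1) b b) M) (trans (⋆-⊛-⋆ (P ^^ 1) (P ^^ 1) ((P ^^ 1) ⋆ (b ⊛ b)) b M)
        (trans (cong (λ t → P ^^ 1 * (P ^^ 1 * t)) (⋆-⊛ (P ^^ 1) (b ⊛ b) b M))
        (solve 2 (λ P t → P :* con 1ℚ :* (P :* con 1ℚ :* (P :* con 1ℚ :* t)) := P :* (P :* (P :* con 1ℚ)) :* t) refl P (((b ⊛ b) ⊛ b) M))))
      difference : σ M - approximation ≡ D M + (- ε M + (½ * U-error M + - (⅙ * W-error M)))
      difference = begin
        σ M - approximation
          ≡⟨ cong₂ (λ u v → σ M - (- (P ^^ 1 * b M + P ^^ 2 * c M + P ^^ 3 * d M) + ½ * u - ⅙ * v))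
               (cong₂ _+_ (sym xx) (cong₂ _+_ (sym xy) (sym xy))) (sym xxx) ⟩
        σ M - (- (x M + y M + z M) + ½ * ((x ⊛ x) M + ((x ⊛ y) M + (x ⊛ y) M)) - ⅙ * ((x ⊛ x) ⊛ x) M)
          -- The `con 0ℚ` is the coefficient of the series 1 at `M`, which is positive. `G M` is a
          -- free variable here: it cancels between `D M` and `ε M`.
          ≡⟨ solve 10 (λ σ x y z xx xy xxx g ue we →
               σ :- ((:- (x :+ y :+ z)) :+ con ½ :* (xx :+ (xy :+ xy)) :- con ⅙ :* xxx)
               := (σ :+ con (- 1ℚ) :* (con 0ℚ :+ con (- 1ℚ) :* g :+ con ½ :* (((xx :+ xy) :+ xy) :+ ue) :+ con (- ⅙) :* (xxx :+ we)))
                  :+ ((:- (g :- (x :+ y :+ z))) :+ (con ½ :* ue :+ (:- (con ⅙ :* we))))) refl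
               (σ M) (x M) (y M) (z M) ((x ⊛ x) M) ((x ⊛ y) M) (((x ⊛ x) ⊛ x) M) (G M) (U-error M) (W-error M) ⟩
        (σ M + - 1ℚ * (0ℚ + - 1ℚ * G M + ½ * ((((x ⊛ x) M + (x ⊛ y) M) + (x ⊛ y) M) + U-error M) + (- ⅙) * (((x ⊛ x) ⊛ x) M + W-error M)))
          + (- ε M + (½ * U-error M + - (⅙ * W-error M)))
          ≡⟨ cong₂ (λ u w → (σ M + - 1ℚ * (0ℚ + - 1ℚ * G M + ½ * u + (- ⅙) * w)) + (- ε M + (½ * U-error M + - (⅙ * W-error M))))
               (sym (U-split M)) (sym (W-split M)) ⟩
        D M + (- ε M + (½ * U-error M + - (⅙ * W-error M))) ∎

    -- Splitting off X/2: the coefficients at 2n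

    private
      Y : Series
      Y = monomial (- ½) 1

      bern-1 : bern 1 ≡ - ½
      bern-1 = begin
        bern 1                    ≡⟨ solve 1 (λ b → b := con ½ :* ((con 1ℚ :* b :+ con 0ℚ) :+ b)) refl (bern 1) ⟩
        ½ * ((1ℚ * bern 1 + 0ℚ) + bern 1)
          ≡⟨ cong (λ t → ½ * (t + bern 1)) (trans (+-identityʳ (1ℚ * bern 1)) (solve 1 (λ b → con 1ℚ :* b := (:- (con (neg1^ 1) :* b))) refl (bern 1))) ⟩
        ½ * (- (neg1^ 1 * bern 1) + bern 1)
          ≡⟨ cong (λ t → ½ * (- t + bern 1)) (reflection 1) ⟩
        ½ * (- (bern 1 + 1ℚ) + bern 1)
          ≡⟨ solve 1 (λ b → con ½ :* ((:- (b :+ con 1ℚ)) :+ b) := con (- ½)) refl (bern 1) ⟩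
        - ½ ∎

      bern-split : bern ≗ E ⊕ Y
      bern-split zero          = solve 1 (λ b → b := b :+ con 0ℚ :+ con 0ℚ) refl (bern 0)
      bern-split (suc zero)    = solve 1 (λ b → b := b :+ con ½ :+ con (- ½)) refl (bern 1)
      bern-split (suc (suc n)) = solve 1 (λ b → b := b :+ con 0ℚ :+ con 0ℚ) refl (bern (2 ℕ.+ n))

      b-split : b ≗ β ⊕ Y
      b-split zero          = solve 1 (λ b → con 0ℚ :* b := con 0ℚ :* (b :+ con 0ℚ) :+ con 0ℚ) refl (bern 0)
      b-split (suc zero)    = solve 1 (λ b → con 1ℚ :* b := con 1ℚ :* (b :+ con ½) :+ con (- ½)) refl (bern 1)
      b-split (suc (suc n)) = solve 2 (λ q b → q :* b := q :* (b :+ con 0ℚ) :+ con 0ℚ) refl (recip (2 ℕ.+ n)) (bern (2 ℕ.+ n))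

      Y⊛ : ∀ f n → (Y ⊛ f) (suc n) ≡ - ½ * f n
      Y⊛ = monomial1-⊛-suc (- ½)

      odd₅ : neg1^ (5 ℕ.+ k₀) ≡ - 1ℚ
      odd₅ = neg1^-pred (5 ℕ.+ k₀) even

    β-0 : β 0 ≡ 0ℚ
    β-0 = *-zeroˡ (E 0)

    β-1 : β 1 ≡ 0ℚ
    β-1 = cong (λ t → 1ℚ * (t + ½)) bern-1

    β-2+ : ∀ n → β (2 ℕ.+ n) ≡ b (2 ℕ.+ n)
    β-2+ n = cong (recip (2 ℕ.+ n) *_) (+-identityʳ (bern (2 ℕ.+ n)))

    -- The product Y β at 2n reads the even series β at the odd index 2n - 1, and Y² is concentrated
    -- at index 2.
    [b⊛b] : (b ⊛ b) (6 ℕ.+ k₀) ≡ (β ⊛ β) (6 ℕ.+ k₀)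
    [b⊛b] = begin
      (b ⊛ b) M
        ≡⟨ ⊛-cong b-split b-split M ⟩
      ((β ⊕ Y) ⊛ (β ⊕ Y)) M
        ≡⟨ expand β Y M ⟩
      (β ⊛ β) M + (Y ⊛ β) M + (Y ⊛ β) M + (Y ⊛ Y) M
        ≡⟨ cong₂ (λ u v → (β ⊛ β) M + u + u + v) (trans (Y⊛ β (5 ℕ.+ k₀)) (cong (- ½ *_) (even-at-odd β-even (5 ℕ.+ k₀) odd₅))) (Y⊛ Y (5 ℕ.+ k₀)) ⟩
      (β ⊛ β) M + - ½ * 0ℚ + - ½ * 0ℚ + - ½ * 0ℚ
        ≡⟨ solve 1 (λ t → t :+ con (- ½) :* con 0ℚ :+ con (- ½) :* con 0ℚ :+ con (- ½) :* con 0ℚ := t) refl ((β ⊛ β) M) ⟩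
      (β ⊛ β) M ∎
      where
      M : ℕ
      M = 6 ℕ.+ k₀
      expand : ∀ β Y → (β ⊕ Y) ⊛ (β ⊕ Y) ≗ β ⊛ β ⊕ Y ⊛ β ⊕ Y ⊛ β ⊕ Y ⊛ Y
      expand = SeriesSolver.solve 2 (λ β Y → (β ⊞ Y) ⊗ (β ⊞ Y) ⊜ β ⊗ β ⊞ Y ⊗ β ⊞ Y ⊗ β ⊞ Y ⊗ Y) λ _ → refl
        where open SeriesSolver renaming (_:+_ to _⊞_; _:*_ to _⊗_; _:=_ to _⊜_)

    -- Moving the factor X/2 of `c` to the front leaves the odd index 2n - 1. There the even product
    -- β E vanishes and Y² is out of range, so only Y (β + E) survives; -1/4 is 1/2 times -1/2.
    [b⊛c] : (b ⊛ c) (6 ℕ.+ k₀) ≡ - (+ 1 / 4) * (β (4 ℕ.+ k₀) + bern (4 ℕ.+ k₀))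
    [b⊛c] = begin
      (b ⊛ c) M
        ≡⟨ swap b (monomial ½ 1) bern M ⟩
      (monomial ½ 1 ⊛ (b ⊛ bern)) M
        ≡⟨ monomial1-⊛-suc ½ (b ⊛ bern) (5 ℕ.+ k₀) ⟩
      ½ * (b ⊛ bern) (5 ℕ.+ k₀)
        ≡⟨ cong (½ *_) (trans (⊛-cong b-split bern-split (5 ℕ.+ k₀)) (expand β Y E (5 ℕ.+ k₀))) ⟩
      ½ * ((β ⊛ E) (5 ℕ.+ k₀) + (Y ⊛ (β ⊕ E)) (5 ℕ.+ k₀) + (Y ⊛ Y) (5 ℕ.+ k₀))
        ≡⟨ cong₂ (λ u v → ½ * (u + v + (Y ⊛ Y) (5 ℕ.+ k₀))) (even-at-odd (even-⊛ β-even E-even) (5 ℕ.+ k₀) odd₅) (Y⊛ (β ⊕ E) (4 ℕ.+ k₀)) ⟩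
      ½ * (0ℚ + - ½ * (β (4 ℕ.+ k₀) + (bern (4 ℕ.+ k₀) + 0ℚ)) + (Y ⊛ Y) (5 ℕ.+ k₀))
        ≡⟨ cong (λ v → ½ * (0ℚ + - ½ * (β (4 ℕ.+ k₀) + (bern (4 ℕ.+ k₀) + 0ℚ)) + v)) (Y⊛ Y (4 ℕ.+ k₀)) ⟩
      ½ * (0ℚ + - ½ * (β (4 ℕ.+ k₀) + (bern (4 ℕ.+ k₀) + 0ℚ)) + - ½ * 0ℚ)
        ≡⟨ solve 2 (λ u v → con ½ :* (con 0ℚ :+ con (- ½) :* (u :+ (v :+ con 0ℚ)) :+ con (- ½) :* con 0ℚ) := con (- (+ 1 / 4)) :* (u :+ v)) refl
             (β (4 ℕ.+ k₀)) (bern (4 ℕ.+ k₀)) ⟩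
      - (+ 1 / 4) * (β (4 ℕ.+ k₀) + bern (4 ℕ.+ k₀)) ∎
      where
      M : ℕ
      M = 6 ℕ.+ k₀
      open SeriesSolver renaming (_:+_ to _⊞_; _:*_ to _⊗_; _:=_ to _⊜_; solve to solve-series) using ()
      swap : ∀ b X B → b ⊛ (X ⊛ B) ≗ X ⊛ (b ⊛ B)
      swap = solve-series 3 (λ b X B → b ⊗ (X ⊗ B) ⊜ X ⊗ (b ⊗ B)) λ _ → refl
      expand : ∀ β Y E → (β ⊕ Y) ⊛ (E ⊕ Y) ≗ β ⊛ E ⊕ Y ⊛ (β ⊕ E) ⊕ Y ⊛ Y
      expand = solve-series 3 (λ β Y E → (β ⊞ Y) ⊗ (E ⊞ Y) ⊜ β ⊗ E ⊞ Y ⊗ (β ⊞ E) ⊞ Y ⊗ Y) λ _ → refl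

    -- Parity removes 3 Y β², and Y³ is concentrated at index 3. Besides β³ there remains 3 Y² β,
    -- whence 3/4.
    [b⊛b⊛b] : ((b ⊛ b) ⊛ b) (6 ℕ.+ k₀) ≡ (β ⊛ (β ⊛ β)) (6 ℕ.+ k₀) + (+ 3 / 4) * β (4 ℕ.+ k₀)
    [b⊛b⊛b] = begin
      ((b ⊛ b) ⊛ b) M
        ≡⟨ trans (⊛-cong (⊛-cong b-split b-split) b-split M) (expand β Y M) ⟩
      (β ⊛ (β ⊛ β)) M + (u + u + u) + (v + v + v) + (Y ⊛ (Y ⊛ Y)) M
        ≡⟨ cong₂ (λ u t → (β ⊛ (β ⊛ β)) M + (u + u + u) + (v + v + v) + t)
             (trans (Y⊛ (β ⊛ β) (5 ℕ.+ k₀)) (cong (- ½ *_) (even-at-odd (even-⊛ β-even β-even) (5 ℕ.+ k₀) odd₅)))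
             (trans (Y⊛ (Y ⊛ Y) (5 ℕ.+ k₀)) (cong (- ½ *_) (Y⊛ Y (4 ℕ.+ k₀)))) ⟩
      (β ⊛ (β ⊛ β)) M + (- ½ * 0ℚ + - ½ * 0ℚ + - ½ * 0ℚ) + (v + v + v) + - ½ * (- ½ * 0ℚ)
        ≡⟨ cong (λ v → (β ⊛ (β ⊛ β)) M + (- ½ * 0ℚ + - ½ * 0ℚ + - ½ * 0ℚ) + (v + v + v) + - ½ * (- ½ * 0ℚ))
             (trans (Y⊛ (Y ⊛ β) (5 ℕ.+ k₀)) (cong (- ½ *_) (Y⊛ β (4 ℕ.+ k₀)))) ⟩
      (β ⊛ (β ⊛ β)) M + (- ½ * 0ℚ + - ½ * 0ℚ + - ½ * 0ℚ) + (w + w + w) + - ½ * (- ½ * 0ℚ)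
        ≡⟨ solve 2 (λ t b → let o = con (- ½) :* con 0ℚ ; w = con (- ½) :* (con (- ½) :* b) in
             t :+ (o :+ o :+ o) :+ (w :+ w :+ w) :+ con (- ½) :* o := t :+ con (+ 3 / 4) :* b) refl ((β ⊛ (β ⊛ β)) M) (β (4 ℕ.+ k₀)) ⟩
      (β ⊛ (β ⊛ β)) M + (+ 3 / 4) * β (4 ℕ.+ k₀) ∎
      where
      M : ℕ
      M = 6 ℕ.+ k₀
      u v w : ℚ
      u = (Y ⊛ (β ⊛ β)) M
      v = (Y ⊛ (Y ⊛ β)) M
      w = - ½ * (- ½ * β (4 ℕ.+ k₀))
      open SeriesSolver renaming (_:+_ to _⊞_; _:*_ to _⊗_; _:=_ to _⊜_; solve to solve-series) using ()
      expand : ∀ β Y → ((β ⊕ Y) ⊛ (β ⊕ Y)) ⊛ (β ⊕ Y) ≗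
        β ⊛ (β ⊛ β) ⊕ (Y ⊛ (β ⊛ β) ⊕ Y ⊛ (β ⊛ β) ⊕ Y ⊛ (β ⊛ β)) ⊕ (Y ⊛ (Y ⊛ β) ⊕ Y ⊛ (Y ⊛ β) ⊕ Y ⊛ (Y ⊛ β)) ⊕ Y ⊛ (Y ⊛ Y)
      expand = solve-series 2 (λ β Y → ((β ⊞ Y) ⊗ (β ⊞ Y)) ⊗ (β ⊞ Y) ⊜
        β ⊗ (β ⊗ β) ⊞ (Y ⊗ (β ⊗ β) ⊞ Y ⊗ (β ⊗ β) ⊞ Y ⊗ (β ⊗ β)) ⊞ (Y ⊗ (Y ⊗ β) ⊞ Y ⊗ (Y ⊗ β) ⊞ Y ⊗ (Y ⊗ β)) ⊞ Y ⊗ (Y ⊗ Y)) λ _ → refl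

    c-M : c (6 ℕ.+ k₀) ≡ 0ℚ
    c-M = trans (c-suc (5 ℕ.+ k₀)) (cong (½ *_) (bern-odd (3 ℕ.+ k₀) odd₅))

    approximation-value : let I = ℕ→ℚ (5 ℕ.+ k₀) in approximation ≡
      - (P ^^ 1 * b (6 ℕ.+ k₀) + P ^^ 3 * (⅙ * (I * bern (4 ℕ.+ k₀))))
        + ½ * (P ^^ 2 * (β ⊛ β) (6 ℕ.+ k₀)) - (+ 1 / 4) * (P ^^ 3 * (b (4 ℕ.+ k₀) + bern (4 ℕ.+ k₀)))
        - ⅙ * (P ^^ 3 * ((β ⊛ (β ⊛ β)) (6 ℕ.+ k₀) + (+ 3 / 4) * b (4 ℕ.+ k₀)))
    approximation-value = begin
      - (Pb + P ^^ 2 * c M + Pd) + ½ * (P ^^ 2 * (b ⊛ b) M + (P ^^ 3 * (b ⊛ c) M + P ^^ 3 * (b ⊛ c) M)) - ⅙ * (P ^^ 3 * ((b ⊛ b) ⊛ b) M)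
        ≡⟨ cong₂ (λ u v → - (Pb + P ^^ 2 * u + Pd) + ½ * (P ^^ 2 * v + (P ^^ 3 * (b ⊛ c) M + P ^^ 3 * (b ⊛ c) M)) - ⅙ * (P ^^ 3 * ((b ⊛ b) ⊛ b) M)) c-M [b⊛b] ⟩
      - (Pb + P ^^ 2 * 0ℚ + Pd) + ½ * (P ^^ 2 * (β ⊛ β) M + (P ^^ 3 * (b ⊛ c) M + P ^^ 3 * (b ⊛ c) M)) - ⅙ * (P ^^ 3 * ((b ⊛ b) ⊛ b) M)
        ≡⟨ cong₂ (λ u v → - (Pb + P ^^ 2 * 0ℚ + Pd) + ½ * (P ^^ 2 * (β ⊛ β) M + (P ^^ 3 * u + P ^^ 3 * u)) - ⅙ * (P ^^ 3 * v))
             (trans [b⊛c] (cong (λ t → - (+ 1 / 4) * (t + bern (4 ℕ.+ k₀))) (β-2+ (2 ℕ.+ k₀))))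
             (trans [b⊛b⊛b] (cong (λ t → (β ⊛ (β ⊛ β)) M + (+ 3 / 4) * t) (β-2+ (2 ℕ.+ k₀)))) ⟩
      - (Pb + P ^^ 2 * 0ℚ + Pd) + ½ * (P ^^ 2 * (β ⊛ β) M + (P ^^ 3 * (- (+ 1 / 4) * b″) + P ^^ 3 * (- (+ 1 / 4) * b″)))
        - ⅙ * (P ^^ 3 * ((β ⊛ (β ⊛ β)) M + (+ 3 / 4) * b (4 ℕ.+ k₀)))
        ≡⟨ solve 7 (λ Pb Pd P2 P3 t b u →
             (:- (Pb :+ P2 :* con 0ℚ :+ Pd)) :+ con ½ :* (P2 :* t :+ (P3 :* (con (- (+ 1 / 4)) :* b) :+ P3 :* (con (- (+ 1 / 4)) :* b))) :- u
             := (:- (Pb :+ Pd)) :+ con ½ :* (P2 :* t) :- con (+ 1 / 4) :* (P3 :* b) :- u) refl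
             Pb Pd (P ^^ 2) (P ^^ 3) ((β ⊛ β) M) b″ (⅙ * (P ^^ 3 * ((β ⊛ (β ⊛ β)) M + (+ 3 / 4) * b (4 ℕ.+ k₀)))) ⟩
      - (Pb + Pd) + ½ * (P ^^ 2 * (β ⊛ β) M) - (+ 1 / 4) * (P ^^ 3 * b″) - ⅙ * (P ^^ 3 * ((β ⊛ (β ⊛ β)) M + (+ 3 / 4) * b (4 ℕ.+ k₀))) ∎
      where
      M : ℕ
      M = 6 ℕ.+ k₀
      Pb Pd b″ : ℚ
      Pb = P ^^ 1 * b M
      Pd = P ^^ 3 * (⅙ * (ℕ→ℚ (5 ℕ.+ k₀) * bern (4 ℕ.+ k₀)))
      b″ = b (4 ℕ.+ k₀) + bern (4 ℕ.+ k₀)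

  -- Reading off the coefficients

  sumTo-shift : ∀ k F i → sumTo k (F ∘ suc) i ≡ sumTo k F (suc i)
  sumTo-shift zero    F i = refl
  sumTo-shift (suc k) F i = cong (_+_ (F (suc i))) (sumTo-shift k F (suc i))

  sumTo-drop : ∀ a d F i → (∀ j → i ℕ.+ a ℕ.≤ j → F j ≡ 0ℚ) → sumTo (a ℕ.+ d) F i ≡ sumTo a F i
  sumTo-drop zero    zero    F i h = refl
  sumTo-drop zero    (suc d) F i h = trans (cong₂ _+_ (h i (ℕ.≤-reflexive (ℕ.+-identityʳ i)))
      (sumTo-drop zero d F (suc i) λ j le → h j (ℕ.<⇒≤ le))) (+-identityˡ 0ℚ)
  sumTo-drop (suc a) d       F i h = cong (_+_ (F i)) (sumTo-drop a d F (suc i) λ j le → h j (subst (ℕ._≤ j) (sym (ℕ.+-suc i a)) le))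

  sumTo-cong : ∀ k {F G} i → (∀ j → i ℕ.≤ j → j ℕ.< i ℕ.+ k → F j ≡ G j) → sumTo k F i ≡ sumTo k G i
  sumTo-cong zero    i h = refl
  sumTo-cong (suc k) i h = cong₂ _+_ (h i ℕ.≤-refl (ℕ.m<m+n i (s≤s z≤n)))
    (sumTo-cong k (suc i) λ j le lt → h j (ℕ.<⇒≤ le) (subst (j ℕ.<_) (sym (ℕ.+-suc i k)) lt))

  ⊛-sumTo : ∀ f g n → (f ⊛ g) n ≡ sumTo (suc n) (λ i → f i * g (n ℕ.∸ i)) 0
  ⊛-sumTo f g zero    = sym (+-identityʳ (f 0 * g 0))
  ⊛-sumTo f g (suc n) = cong (_+_ (f 0 * g (suc n)))
    (trans (⊛-sumTo (f ∘ suc) g n) (sumTo-shift (suc n) (λ i → f i * g (suc n ℕ.∸ i)) 0))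

  -- The zeros of `f` and `g` cut the Cauchy product down to i from 2 to e + 1. With d = 1 this is
  -- the range in `𝓒`; with d = 3 it is the range in `𝓣`, as β² starts at index 4.
  ⊛-sumFromTo : ∀ f g d e → f 0 ≡ 0ℚ → f 1 ≡ 0ℚ → (∀ j → j ℕ.≤ d → g j ≡ 0ℚ) →
    (f ⊛ g) (2 ℕ.+ d ℕ.+ e) ≡ sumTo e (λ i → f i * g (2 ℕ.+ d ℕ.+ e ℕ.∸ i)) 2
  ⊛-sumFromTo f g d e f0 f1 gd = begin
    (f ⊛ g) n
      ≡⟨ ⊛-sumTo f g n ⟩
    F 0 + (F 1 + sumTo (suc d ℕ.+ e) F 2)
      ≡⟨ cong₂ (λ u v → u * g n + (v * g (n ℕ.∸ 1) + sumTo (suc d ℕ.+ e) F 2)) f0 f1 ⟩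
    0ℚ * g n + (0ℚ * g (n ℕ.∸ 1) + sumTo (suc d ℕ.+ e) F 2)
      ≡⟨ solve 3 (λ x y z → con 0ℚ :* x :+ (con 0ℚ :* y :+ z) := z) refl (g n) (g (n ℕ.∸ 1)) (sumTo (suc d ℕ.+ e) F 2) ⟩
    sumTo (suc d ℕ.+ e) F 2
      ≡⟨ cong (λ m → sumTo m F 2) (ℕ.+-comm (suc d) e) ⟩
    sumTo (e ℕ.+ suc d) F 2
      ≡⟨ sumTo-drop e (suc d) F 2 (λ j le → trans (cong (f j *_) (gd (n ℕ.∸ j)
           (ℕ.≤-trans (ℕ.∸-monoʳ-≤ n le) (ℕ.≤-reflexive (ℕ.m+n∸n≡m d e))))) (*-zeroʳ (f j))) ⟩
    sumTo e F 2 ∎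
    where
    n : ℕ
    n = 2 ℕ.+ d ℕ.+ e
    F : ℕ → ℚ
    F i = f i * g (n ℕ.∸ i)

  module _ (β : Series) (β0 : β 0 ≡ 0ℚ) (β1 : β 1 ≡ 0ℚ) (β≡𝓑 : ∀ j → 2 ℕ.≤ j → β j ≡ 𝓑 j) where

    private
      ∸-lower : ∀ {a n j} d → n ≡ a ℕ.+ d → j ℕ.≤ d → a ℕ.≤ n ℕ.∸ j
      ∸-lower {a} {n} d e le = ℕ.≤-trans (ℕ.≤-reflexive (sym (trans (cong (ℕ._∸ d) e) (ℕ.m+n∸n≡m a d)))) (ℕ.∸-monoʳ-≤ n le)

    β⊛β≡𝓒 : ∀ n → 3 ℕ.≤ n → (β ⊛ β) n ≡ 𝓒 n
    β⊛β≡𝓒 (suc zero)          (s≤s ())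
    β⊛β≡𝓒 (suc (suc zero))    (s≤s (s≤s ()))
    β⊛β≡𝓒 (suc (suc (suc e))) _ = trans
      (⊛-sumFromTo β β 1 e β0 β1 λ { zero _ → β0 ; (suc zero) _ → β1 ; (suc (suc j)) (s≤s ()) })
      (trans (sumTo-cong e 2 λ j le lt → cong₂ _*_ (β≡𝓑 j le) (β≡𝓑 (3 ℕ.+ e ℕ.∸ j) (∸-lower {2} (suc e) refl (ℕ.s≤s⁻¹ lt))))
      (sym (sumFromTo-sumTo 2 (suc e) (λ i → 𝓑 i * 𝓑 (3 ℕ.+ e ℕ.∸ i)))))

    β⊛β-vanishes : ∀ j → j ℕ.≤ 3 → (β ⊛ β) j ≡ 0ℚ
    β⊛β-vanishes n n≤3 = ⊛-closed (_≡ 0ℚ) (λ e e′ → cong₂ _+_ e e′) β β n term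
      where
      term : ∀ i j → i ℕ.+ j ≡ n → β i * β j ≡ 0ℚ
      term zero          j             _ = trans (cong (_* β j) β0) (*-zeroˡ (β j))
      term (suc zero)    j             _ = trans (cong (_* β j) β1) (*-zeroˡ (β j))
      term (suc (suc i)) zero          _ = trans (cong (β (2 ℕ.+ i) *_) β0) (*-zeroʳ (β (2 ℕ.+ i)))
      term (suc (suc i)) (suc zero)    _ = trans (cong (β (2 ℕ.+ i) *_) β1) (*-zeroʳ (β (2 ℕ.+ i)))
      term (suc (suc i)) (suc (suc j)) e = contradiction
        (ℕ.≤-trans (ℕ.+-mono-≤ (ℕ.m≤m+n 2 i) (ℕ.m≤m+n 2 j)) (ℕ.≤-trans (ℕ.≤-reflexive e) n≤3)) λ { (s≤s (s≤s (s≤s ()))) }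

    β⊛β⊛β≡𝓣 : ∀ e → (β ⊛ (β ⊛ β)) (5 ℕ.+ e) ≡ 𝓣 (5 ℕ.+ e)
    β⊛β⊛β≡𝓣 e = trans (⊛-sumFromTo β (β ⊛ β) 3 e β0 β1 β⊛β-vanishes)
      (trans (sumTo-cong e 2 λ j le lt → cong₂ _*_ (β≡𝓑 j le) (β⊛β≡𝓒 (5 ℕ.+ e ℕ.∸ j)
        (ℕ.<⇒≤ (∸-lower {4} (suc e) refl (ℕ.s≤s⁻¹ lt)))))
      (sym (sumFromTo-sumTo 2 (suc e) (λ i → 𝓑 i * 𝓒 (5 ℕ.+ e ℕ.∸ i)))))

  neg1^-double : ∀ n → neg1^ (2 ℕ.* n) ≡ 1ℚ
  neg1^-double n = trans (^^-+ (- 1ℚ) n (n ℕ.+ 0)) (trans (cong (λ m → neg1^ n * neg1^ m) (ℕ.+-identityʳ n)) (neg1^-square n))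

  -- Origin of 16n² - 12n + 5: to the coefficient of -p³ times the divided Bernoulli number at 2n -
  -- 2, the series d contributes (2n - 1)(2n - 2)/6, the product b c contributes (2n - 1)/4, and b³
  -- contributes (1/6)(3/4) = 1/8.
  assemble : ∀ P μ b b′ C T → let Z = ℕ→ℚ 2 * μ - ℕ→ℚ 2 in
    - (P ^^ 1 * b + P ^^ 3 * (⅙ * ((1ℚ + Z) * (Z * b′))))
      + ½ * (P ^^ 2 * C) - (+ 1 / 4) * (P ^^ 3 * (b′ + Z * b′)) - ⅙ * (P ^^ 3 * (T + (+ 3 / 4) * b′))
    ≡ (P * P * ½ * C - P * b - (P * P * P) * ⅙ * T) - ((ℕ→ℚ 16 * μ * μ + ℕ→ℚ 5 - ℕ→ℚ 12 * μ) * (+ 1 / 24) * (P * P * P)) * b′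
  assemble = solve 6 (λ P μ b b′ C T → let Z = con (ℕ→ℚ 2) :* μ :- con (ℕ→ℚ 2) ; P1 = P :* con 1ℚ ; P2 = P :* P1 ; P3 = P :* P2 in
    (:- (P1 :* b :+ P3 :* (con ⅙ :* ((con 1ℚ :+ Z) :* (Z :* b′)))))
      :+ con ½ :* (P2 :* C) :- con (+ 1 / 4) :* (P3 :* (b′ :+ Z :* b′)) :- con ⅙ :* (P3 :* (T :+ con (+ 3 / 4) :* b′))
    := (P :* P :* con ½ :* C :- P :* b :- (P :* P :* P) :* con ⅙ :* T)
       :- ((con (ℕ→ℚ 16) :* μ :* μ :+ con (ℕ→ℚ 5) :- con (ℕ→ℚ 12) :* μ) :* con (+ 1 / 24) :* (P :* P :* P)) :* b′) refl

  congruence : ∀ N n k₀ → 2 ℕ.* n ≡ 6 ℕ.+ k₀ → Prime (suc N) → 6 ℕ.+ k₀ ℕ.≤ N →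
    ℕ→ℚ (A (suc N) (6 ℕ.+ k₀)) ≡
      ((((ℕ→ℚ (suc N ℕ.* suc N) * (+ 1 / 2)) * 𝓒 (6 ℕ.+ k₀)
        - ℕ→ℚ (suc N) * 𝓑 (6 ℕ.+ k₀))
        - (ℕ→ℚ (suc N ℕ.* suc N ℕ.* suc N) * (+ 1 / 6)) * 𝓣 (6 ℕ.+ k₀))
        - ((((ℕ→ℚ (16 ℕ.* n ℕ.* n ℕ.+ 5) - ℕ→ℚ (12 ℕ.* n)) * (+ 1 / 24)) * ℕ→ℚ (suc N ℕ.* suc N ℕ.* suc N)) * 𝓑 (4 ℕ.+ k₀)))
      [mod suc N ^ 4 ]
  congruence N n k₀ 2n≡M p-prime M≤N = pow⇒InPowZp (subst (Pow 4) (cong₂ _-_ σ≡A (trans approximation-value rhs)) σ-approximation)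
    where
    M : ℕ
    M = 6 ℕ.+ k₀
    even : neg1^ M ≡ 1ℚ
    even = subst (λ m → neg1^ m ≡ 1ℚ) 2n≡M (neg1^-double n)
    open PAdic (suc N) p-prime
    open Core N p-prime k₀ M≤N even B B-recurrence
    σ≡A : σ M ≡ ℕ→ℚ (A (suc N) M)
    σ≡A = trans (cong (_* ℕ→ℚ (elemSym M (range1 N))) even) (*-identityˡ (ℕ→ℚ (elemSym M (range1 N))))
    b≡𝓑 : ∀ j → b (2 ℕ.+ j) ≡ 𝓑 (2 ℕ.+ j)
    b≡𝓑 j = *-comm (recip (2 ℕ.+ j)) (B (2 ℕ.+ j))
    β≡𝓑 : ∀ j → 2 ℕ.≤ j → β j ≡ 𝓑 j
    β≡𝓑 (suc zero)    (s≤s ())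
    β≡𝓑 (suc (suc j)) _ = trans (β-2+ j) (b≡𝓑 j)
    μ Z b′ : ℚ
    μ = ℕ→ℚ n
    Z = ℕ→ℚ 2 * μ - ℕ→ℚ 2
    b′ = 𝓑 (4 ℕ.+ k₀)
    Z≡ : ℕ→ℚ (4 ℕ.+ k₀) ≡ Z
    Z≡ = begin
      ℕ→ℚ (4 ℕ.+ k₀)
        ≡⟨ solve 2 (λ z t → z := (t :+ z) :- t) refl (ℕ→ℚ (4 ℕ.+ k₀)) (ℕ→ℚ 2) ⟩
      (ℕ→ℚ 2 + ℕ→ℚ (4 ℕ.+ k₀)) - ℕ→ℚ 2
        ≡⟨ cong (_- ℕ→ℚ 2) (trans (sym (ℕ→ℚ-+ 2 (4 ℕ.+ k₀))) (trans (cong ℕ→ℚ (sym 2n≡M)) (ℕ→ℚ-* 2 n))) ⟩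
      Z ∎
    I≡ : ℕ→ℚ (5 ℕ.+ k₀) ≡ 1ℚ + Z
    I≡ = trans (ℕ→ℚ-suc (4 ℕ.+ k₀)) (cong (_+_ 1ℚ) Z≡)
    B≡ : B (4 ℕ.+ k₀) ≡ Z * b′
    B≡ = sym (trans (cong (_* b′) (sym Z≡)) (cancel (B (4 ℕ.+ k₀)) (+ 1 / (4 ℕ.+ k₀)) (ℕ→ℚ (4 ℕ.+ k₀)) (1/n*n≡1 (3 ℕ.+ k₀))))
      where
      cancel : ∀ x q m → q * m ≡ 1ℚ → m * (x * q) ≡ x
      cancel x q m e = trans (solve 3 (λ x q m → m :* (x :* q) := x :* (q :* m)) refl x q m) (trans (cong (x *_) e) (*-identityʳ x))
    PP≡ : ℕ→ℚ (suc N ℕ.* suc N) ≡ P * P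
    PP≡ = ℕ→ℚ-* (suc N) (suc N)
    PPP≡ : ℕ→ℚ (suc N ℕ.* suc N ℕ.* suc N) ≡ P * P * P
    PPP≡ = trans (ℕ→ℚ-* (suc N ℕ.* suc N) (suc N)) (cong (_* P) PP≡)
    num≡ : ℕ→ℚ (16 ℕ.* n ℕ.* n ℕ.+ 5) - ℕ→ℚ (12 ℕ.* n) ≡ ℕ→ℚ 16 * μ * μ + ℕ→ℚ 5 - ℕ→ℚ 12 * μ
    num≡ = cong₂ _-_ (trans (ℕ→ℚ-+ (16 ℕ.* n ℕ.* n) 5) (cong (_+ ℕ→ℚ 5) (trans (ℕ→ℚ-* (16 ℕ.* n) n) (cong (_* μ) (ℕ→ℚ-* 16 n)))))
                    (ℕ→ℚ-* 12 n)
    value : ℚ → ℚ → ℚ → ℚ → ℚ → ℚ → ℚ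
    value bM I b4 B4 C T = - (P ^^ 1 * bM + P ^^ 3 * (⅙ * (I * B4))) + ½ * (P ^^ 2 * C) - (+ 1 / 4) * (P ^^ 3 * (b4 + B4)) - ⅙ * (P ^^ 3 * (T + (+ 3 / 4) * b4))
    target : ℚ → ℚ → ℚ → ℚ
    target pp ppp num = (pp * ½ * 𝓒 M - P * 𝓑 M - ppp * ⅙ * 𝓣 M) - (num * (+ 1 / 24) * ppp) * b′
    rhs : value (b M) (ℕ→ℚ (5 ℕ.+ k₀)) (b (4 ℕ.+ k₀)) (B (4 ℕ.+ k₀)) ((β ⊛ β) M) ((β ⊛ (β ⊛ β)) M)
        ≡ target (ℕ→ℚ (suc N ℕ.* suc N)) (ℕ→ℚ (suc N ℕ.* suc N ℕ.* suc N)) (ℕ→ℚ (16 ℕ.* n ℕ.* n ℕ.+ 5) - ℕ→ℚ (12 ℕ.* n))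
    rhs = begin
      value (b M) (ℕ→ℚ (5 ℕ.+ k₀)) (b (4 ℕ.+ k₀)) (B (4 ℕ.+ k₀)) ((β ⊛ β) M) ((β ⊛ (β ⊛ β)) M)
        ≡⟨ cong₂ (λ u v → value u (ℕ→ℚ (5 ℕ.+ k₀)) v (B (4 ℕ.+ k₀)) ((β ⊛ β) M) ((β ⊛ (β ⊛ β)) M)) (b≡𝓑 (4 ℕ.+ k₀)) (b≡𝓑 (2 ℕ.+ k₀)) ⟩
      value (𝓑 M) (ℕ→ℚ (5 ℕ.+ k₀)) b′ (B (4 ℕ.+ k₀)) ((β ⊛ β) M) ((β ⊛ (β ⊛ β)) M)
        ≡⟨ cong₂ (λ u v → value (𝓑 M) u b′ v ((β ⊛ β) M) ((β ⊛ (β ⊛ β)) M)) I≡ B≡ ⟩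
      value (𝓑 M) (1ℚ + Z) b′ (Z * b′) ((β ⊛ β) M) ((β ⊛ (β ⊛ β)) M)
        ≡⟨ cong₂ (λ u v → value (𝓑 M) (1ℚ + Z) b′ (Z * b′) u v)
             (β⊛β≡𝓒 β β-0 β-1 β≡𝓑 M (s≤s (s≤s (s≤s z≤n)))) (β⊛β⊛β≡𝓣 β β-0 β-1 β≡𝓑 (1 ℕ.+ k₀)) ⟩
      value (𝓑 M) (1ℚ + Z) b′ (Z * b′) (𝓒 M) (𝓣 M)
        ≡⟨ assemble P μ (𝓑 M) b′ (𝓒 M) (𝓣 M) ⟩
      target (P * P) (P * P * P) (ℕ→ℚ 16 * μ * μ + ℕ→ℚ 5 - ℕ→ℚ 12 * μ)
        ≡⟨ cong₂ (λ u v → target u v (ℕ→ℚ 16 * μ * μ + ℕ→ℚ 5 - ℕ→ℚ 12 * μ)) (sym PP≡) (sym PPP≡) ⟩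
      target (ℕ→ℚ (suc N ℕ.* suc N)) (ℕ→ℚ (suc N ℕ.* suc N ℕ.* suc N)) (ℕ→ℚ 16 * μ * μ + ℕ→ℚ 5 - ℕ→ℚ 12 * μ)
        ≡⟨ cong (target (ℕ→ℚ (suc N ℕ.* suc N)) (ℕ→ℚ (suc N ℕ.* suc N ℕ.* suc N))) (sym num≡) ⟩
      target (ℕ→ℚ (suc N ℕ.* suc N)) (ℕ→ℚ (suc N ℕ.* suc N ℕ.* suc N)) (ℕ→ℚ (16 ℕ.* n ℕ.* n ℕ.+ 5) - ℕ→ℚ (12 ℕ.* n)) ∎

-- Transfer to the statement in terms of p and n

open import Data.Nat using (ℕ; _≤_; _*_; _∸_; _+_)
open import Data.Nat.Primality using (Prime)
open import Relation.Binary.PropositionalEquality using (_≢_)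
open import Data.Integer using (+_)
open import Data.Rational using (_/_) renaming (_+_ to _+ℚ_; _-_ to _-ℚ_; _*_ to _*ℚ_)
open import Data.Nat using (zero; suc)
import Data.Nat.Properties as ℕ
import Relation.Binary.PropositionalEquality as Eq

theorem1 : (p n : ℕ) → Prime p → p ≢ 2 → 6 ≤ 2 * n → 2 * n ≤ p ∸ 1 →
    ℕ→ℚ (A p (2 * n)) ≡
    ((((ℕ→ℚ (p * p) *ℚ (+ 1 / 2)) *ℚ 𝓒 (2 * n)
    -ℚ ℕ→ℚ p *ℚ 𝓑 (2 * n))
    -ℚ (ℕ→ℚ (p * p * p) *ℚ (+ 1 / 6)) *ℚ 𝓣 (2 * n))
    -ℚ ((((ℕ→ℚ (16 * n * n + 5) -ℚ ℕ→ℚ (12 * n)) *ℚ (+ 1 / 24)) *ℚ ℕ→ℚ (p * p * p)) *ℚ 𝓑 (2 * n ∸ 2)))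
    [mod p ^ 4 ]
theorem1 zero    n p-prime p≢2 6≤2n 2n≤p-1 with () ← ℕ.≤-trans 6≤2n 2n≤p-1
theorem1 (suc N) n p-prime p≢2 6≤2n 2n≤p-1 = at (2 * n) (2 * n ∸ 6) Eq.refl (Eq.sym (ℕ.m+[n∸m]≡n 6≤2n)) 2n≤p-1
  where
  -- With 2n replaced by a variable, its equation with 6 + k can be matched, and `m ∸ 2` computes to
  -- 4 + k.
  at : ∀ m k → 2 * n Eq.≡ m → m Eq.≡ 6 + k → m ≤ N →
    ℕ→ℚ (A (suc N) m) ≡
    ((((ℕ→ℚ (suc N * suc N) *ℚ (+ 1 / 2)) *ℚ 𝓒 m
    -ℚ ℕ→ℚ (suc N) *ℚ 𝓑 m)
    -ℚ (ℕ→ℚ (suc N * suc N * suc N) *ℚ (+ 1 / 6)) *ℚ 𝓣 m)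
    -ℚ ((((ℕ→ℚ (16 * n * n + 5) -ℚ ℕ→ℚ (12 * n)) *ℚ (+ 1 / 24)) *ℚ ℕ→ℚ (suc N * suc N * suc N)) *ℚ 𝓑 (m ∸ 2)))
    [mod suc N ^ 4 ]
  at m k 2n≡m Eq.refl m≤N = Development.congruence N n k 2n≡m p-prime m≤N
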